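{- Let $\phi(q)=\sum_{n=0}^\infty \frac{q^{n^2}}{(-q^2;q^2)_n}$, and for $n\ge1$ let $p^e_{do}(n)$ denote the number of partitions of $n$ into an even number of distinct parts with the smallest part being odd. Then \[ (-q;q)_\infty\,\phi(-q)=1+2\sum_{n\ge 1}p^e_{do}(n)q^n. \]
   Context: Notation: $(a;q)_n=(1-a)(1-aq)\cdots(1-aq^{n-1})$ and $(a;q)_\infty=\prod_{n\ge 0}(1-aq^n)$, $|q|<1$. -}

module Defs where

open import Data.Nat as ℕ using (ℕ; zero; suc; _%_; _≤_)
open import Data.Integer as ℤ using (ℤ; +_; -_; _+_; _*_)
open import Data.List using (List; []; _∷_; upTo; map; zipWith; foldr; length; last)
open import Data.Maybe using (just)
open import Data.Product using (Σ; _×_)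
open import Data.List.Relation.Unary.All using (All)
open import Data.List.Relation.Unary.Linked using (Linked)
open import Relation.Binary.PropositionalEquality using (_≡_)
open import Relation.Nullary using (yes; no)

Series : Set
Series = ℕ → ℤ

sumℤ : List ℤ → ℤ
sumℤ = foldr _+_ (+ 0)

oneS : Series
oneS zero    = + 1
oneS (suc _) = + 0

qPow : ℕ → Series
qPow k n with k ℕ.≟ n
... | yes _ = + 1
... | no  _ = + 0

_+S_ : Series → Series → Series
(f +S g) n = f n + g n

_*S_ : Series → Series → Series
(f *S g) n = sumℤ (map (λ i → f i * g (n ℕ.∸ i)) (upTo (suc n)))

prodS : ℕ → (ℕ → Series) → Series
prodS zero    F = oneS
prodS (suc m) F = prodS m F *S F m

-- Multiplicative inverse of a series with constant term 1:
-- b_0 = 1, b_{n+1} = - Σ_{i=1}^{n+1} f_i b_{n+1-i}.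
-- invUpTo f n = [b_n , b_{n-1} , … , b_0].
invUpTo : Series → ℕ → List ℤ
invUpTo f zero    = + 1 ∷ []
invUpTo f (suc n) =
  (- sumℤ (zipWith _*_ (map (λ i → f (suc i)) (upTo (suc n))) prev)) ∷ prev
  where prev = invUpTo f n

headℤ : List ℤ → ℤ
headℤ []      = + 0
headℤ (x ∷ _) = x

invS : Series → Series
invS f n = headℤ (invUpTo f n)

-- Infinite sum Σ_{m≥0} F m of a family with ord(F m) ≥ m:
-- the n-th coefficient only receives contributions from m ≤ n.
sumFam : (ℕ → Series) → Series
sumFam F n = sumℤ (map (λ m → F m n) (upTo (suc n)))

-- Infinite product Π_{k≥0} (1 + G k) with ord(G k) ≥ k+1:
-- the n-th coefficient equals that of the finite product over k < n.
prodFam1+ : (ℕ → Series) → Series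
prodFam1+ G n = prodS n (λ k → oneS +S G k) n

negArg : Series → Series
negArg f n = (- (+ 1)) ℤ.^ n * f n

poch-q2 : ℕ → Series
poch-q2 m = prodS m (λ j → oneS +S qPow (2 ℕ.+ 2 ℕ.* j))

poch-q-inf : Series
poch-q-inf = prodFam1+ (λ k → qPow (suc k))

phi : Series
phi = sumFam (λ m → qPow (m ℕ.* m) *S invS (poch-q2 m))

IsDistinctPartition : ℕ → List ℕ → Set
IsDistinctPartition n xs =
  Linked ℕ._>_ xs × All (λ x → 1 ≤ x) xs × foldr ℕ._+_ 0 xs ≡ n

IsPdoE : ℕ → List ℕ → Set
IsPdoE n xs =
  IsDistinctPartition n xs × length xs % 2 ≡ 0 ×
  Σ ℕ (λ s → last xs ≡ just s × s % 2 ≡ 1)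

{-# OPTIONS --safe #-}

-- Write E(x) = Π_{i≥1} (1 + x q^{2i}).  For S_j = Σ_m (-1)^m q^{m²} E(q^{2m+2j}),
-- the left-hand side is (-q;q²)_∞ S_0, and shifting m by one in the sum gives
--   (1 + q^{2j+1}) S_j = S_{j+1} + q^{2j+1} E(q^{2j}).
-- Multiplied by (-q^{2j+1};q²)_∞, this peels off, one odd smallest part 2j+1 at a time, the generating
-- function of the partitions into distinct parts with odd smallest part, and leaves
-- the partial theta series Σ_m (-1)^m q^{m²}.  That series is in turn 1 plus the
-- generating function of the same partitions weighted by (-1)^{number of parts}:
--   H_j = Σ_k q^{2k} (q^{2k+2};q²)_∞ (q^{2k+2j+1};q²)_∞
-- satisfies H_j + q^{2j+1} H_{j+1} = 1 by telescoping, and H_0 is that weighted series.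
-- Odd numbers of parts cancel in the sum of the two, even ones are counted twice.
-- Everything takes place in ℤ[[q]] / (q^{N+1}), where infinite products are finite.
module Submission where

open import Defs
open import Algebra.Bundles using (CommutativeRing)
open import Data.Nat as ℕ using (ℕ; zero; suc; z≤n; s≤s; _%_)
import Data.Nat.Properties as ℕₚ
import Relation.Binary.PropositionalEquality as ≡
open ≡ using (_≡_)

-- Finite sums and products in a commutative ring, and truncated infinite products.

module NilpotentBase {c ℓ} (R : CommutativeRing c ℓ) where
  open CommutativeRing R
  open import Relation.Binary.Reasoning.Setoid setoid
  open import Algebra.Solver.Ring.NaturalCoefficients.Default commutativeSemiring
    using (solve; _:=_; _:+_; _:*_; con)

  ∑ ∏ : ℕ → (ℕ → Carrier) → Carrier
  ∑ zero    f = 0#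
  ∑ (suc n) f = ∑ n f + f n
  ∏ zero    f = 1#
  ∏ (suc n) f = ∏ n f * f n

  ∑-cong : ∀ n {f g} → (∀ i → f i ≈ g i) → ∑ n f ≈ ∑ n g
  ∑-cong zero    f≈g = refl
  ∑-cong (suc n) f≈g = +-cong (∑-cong n f≈g) (f≈g n)

  ∏-cong : ∀ n {f g} → (∀ i → f i ≈ g i) → ∏ n f ≈ ∏ n g
  ∏-cong zero    f≈g = refl
  ∏-cong (suc n) f≈g = *-cong (∏-cong n f≈g) (f≈g n)

  *-distribˡ-∑ : ∀ x n f → x * ∑ n f ≈ ∑ n (λ i → x * f i)
  *-distribˡ-∑ x zero    f = zeroʳ x
  *-distribˡ-∑ x (suc n) f = trans (distribˡ x _ _) (+-congʳ (*-distribˡ-∑ x n f))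

  ∏-ones : ∀ n {f} → (∀ i → f i ≈ 1#) → ∏ n f ≈ 1#
  ∏-ones zero    f≈1 = refl
  ∏-ones (suc n) f≈1 = trans (*-cong (∏-ones n f≈1) (f≈1 n)) (*-identityˡ 1#)

  ∏-shift : ∀ n f → ∏ (suc n) f ≈ f 0 * ∏ n (λ i → f (suc i))
  ∏-shift zero    f = *-comm 1# (f 0)
  ∏-shift (suc n) f = trans (*-congʳ (∏-shift n f)) (*-assoc _ _ _)

  -- Grouping consecutive factors in pairs separates even from odd indices; this is how the product
  -- of all `1 + q^k` is split into `O` and `E`.
  ∏-pairs : ∀ n f → ∏ (n ℕ.+ n) f ≈ ∏ n (λ i → f (2 ℕ.* i)) * ∏ n (λ i → f (1 ℕ.+ 2 ℕ.* i))
  ∏-pairs zero    f = sym (*-identityˡ 1#)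
  ∏-pairs (suc n) f = begin
    ∏ (suc n ℕ.+ suc n) f
      ≡⟨ ≡.cong (λ k → ∏ (suc k) f) (ℕₚ.+-suc n n) ⟩
    ∏ (n ℕ.+ n) f * f (n ℕ.+ n) * f (suc (n ℕ.+ n))
      ≡⟨ ≡.cong (λ k → ∏ (n ℕ.+ n) f * f k * f (suc k)) n+n≡2n ⟩
    ∏ (n ℕ.+ n) f * f (2 ℕ.* n) * f (1 ℕ.+ 2 ℕ.* n)
      ≈⟨ *-congʳ (*-congʳ (∏-pairs n f)) ⟩
    (∏ n _ * ∏ n _) * f (2 ℕ.* n) * f (1 ℕ.+ 2 ℕ.* n)
      ≈⟨ solve 4 (λ a b c d → a :* b :* c :* d := (a :* c) :* (b :* d)) refl _ _ _ _ ⟩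
    (∏ n _ * f (2 ℕ.* n)) * (∏ n _ * f (1 ℕ.+ 2 ℕ.* n)) ∎
    where
    n+n≡2n : n ℕ.+ n ≡ 2 ℕ.* n
    n+n≡2n = ≡.cong (n ℕ.+_) (≡.sym (ℕₚ.+-identityʳ n))

  -- For c vanishing beyond N, tail N c k plays the role of the infinite
  -- product Π_{i≥k} (1 + c i).
  tail : ℕ → (ℕ → Carrier) → ℕ → Carrier
  tail N c k = ∏ (suc N) (λ i → 1# + c (k ℕ.+ i))

  module _ {N : ℕ} {c : ℕ → Carrier} (c-vanish : ∀ i → N ℕ.< i → c i ≈ 0#) where

    1+c≈1 : ∀ i → N ℕ.< i → 1# + c i ≈ 1#
    1+c≈1 i N<i = trans (+-congˡ (c-vanish i N<i)) (+-identityʳ 1#)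

    tail-step : ∀ k → tail N c k ≈ (1# + c k) * tail N c (suc k)
    tail-step k = begin
      tail N c k
        ≈⟨ *-identityʳ _ ⟨
      tail N c k * 1#
        -- The window of `suc N` factors is extended by the one at index `k + suc N`, which exceeds
        -- `N` and hence equals 1; the first factor can then be split off with the window length
        -- unchanged.
        ≈⟨ *-congˡ (1+c≈1 (k ℕ.+ suc N) (ℕₚ.m≤n+m (suc N) k)) ⟨
      ∏ (suc (suc N)) (λ i → 1# + c (k ℕ.+ i))
        ≈⟨ ∏-shift (suc N) (λ i → 1# + c (k ℕ.+ i)) ⟩
      (1# + c (k ℕ.+ 0)) * ∏ (suc N) (λ i → 1# + c (k ℕ.+ suc i))
        ≈⟨ *-cong (1+c≡ (ℕₚ.+-identityʳ k)) (∏-cong (suc N) (λ i → 1+c≡ (ℕₚ.+-suc k i))) ⟩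
      (1# + c k) * tail N c (suc k) ∎
      where
      1+c≡ : ∀ {i j} → i ≡ j → 1# + c i ≈ 1# + c j
      1+c≡ i≡j = reflexive (≡.cong (λ i → 1# + c i) i≡j)

    tail≈1 : ∀ k → N ℕ.< k → tail N c k ≈ 1#
    tail≈1 k N<k = ∏-ones (suc N) (λ i → 1+c≈1 (k ℕ.+ i) (ℕₚ.≤-trans N<k (ℕₚ.m≤m+n k i)))

  -- Powers of q modulo q^(N+1) and the four infinite products.

  -- p i stands for q^i, and q^i = 0 for i > N.
  module MockTheta (N : ℕ) (p : ℕ → Carrier) (p-zero : p 0 ≈ 1#)
    (p-+ : ∀ i j → p (i ℕ.+ j) ≈ p i * p j) (p-vanish : ∀ i → N ℕ.< i → p i ≈ 0#) where

    n≤2n : ∀ n → n ℕ.≤ 2 ℕ.* n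
    n≤2n n = ℕₚ.m≤m+n n (n ℕ.+ 0)

    even odd even⁻ odd⁻ : ℕ → Carrier
    even i = p (2 ℕ.* i)
    odd i = p (1 ℕ.+ 2 ℕ.* i)
    even⁻ i = - even i
    odd⁻ i = - odd i

    odd-+ : ∀ i j → odd (i ℕ.+ j) ≈ even i * odd j
    odd-+ i j = trans (reflexive (≡.cong p index)) (p-+ (2 ℕ.* i) (1 ℕ.+ 2 ℕ.* j))
      where
      index : 1 ℕ.+ 2 ℕ.* (i ℕ.+ j) ≡ 2 ℕ.* i ℕ.+ (1 ℕ.+ 2 ℕ.* j)
      index = ≡.trans (≡.cong suc (ℕₚ.*-distribˡ-+ 2 i j)) (≡.sym (ℕₚ.+-suc (2 ℕ.* i) (2 ℕ.* j)))

    -- Needed in `S-partial`: it lets the exponent of a factor of `E` meet the factor `odd L` that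
    -- links consecutive `t`.
    even-suc-+ : ∀ i j → even (suc (i ℕ.+ j)) ≈ odd i * odd j
    even-suc-+ i j = trans (reflexive (≡.cong p index)) (p-+ (1 ℕ.+ 2 ℕ.* i) (1 ℕ.+ 2 ℕ.* j))
      where
      index : 2 ℕ.* suc (i ℕ.+ j) ≡ 1 ℕ.+ 2 ℕ.* i ℕ.+ (1 ℕ.+ 2 ℕ.* j)
      index = ≡.trans (ℕₚ.*-suc 2 (i ℕ.+ j)) (≡.cong suc (≡.trans (≡.cong suc (ℕₚ.*-distribˡ-+ 2 i j))
                (≡.sym (ℕₚ.+-suc (2 ℕ.* i) (2 ℕ.* j)))))

    even-vanish : ∀ i → N ℕ.< i → even i ≈ 0#
    even-vanish i N<i = p-vanish _ (ℕₚ.≤-trans N<i (n≤2n i))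

    -- The bound includes `i = N`, because 2N+1 > N; `t-vanish` relies on this boundary case.
    odd-vanish : ∀ i → N ℕ.≤ i → odd i ≈ 0#
    odd-vanish i N≤i = p-vanish _ (ℕ.s≤s (ℕₚ.≤-trans N≤i (n≤2n i)))

    neg-vanish : ∀ {x} → x ≈ 0# → - x ≈ 0#
    neg-vanish x≈0 = trans (-‿cong x≈0) -0#≈0#
      where open import Algebra.Properties.Ring ring using (-0#≈0#)

    -- In q-Pochhammer notation: (-q^(2k);q²)_∞, (-q^(2k+1);q²)_∞, (q^(2k);q²)_∞ and (q^(2k+1);q²)_∞
    -- at index k.
    E O E⁻ O⁻ : ℕ → Carrier
    E  = tail N even
    O  = tail N odd
    E⁻ = tail N even⁻
    O⁻ = tail N odd⁻

    E-step : ∀ k → E k ≈ (1# + even k) * E (suc k)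
    E-step = tail-step even-vanish

    O-step : ∀ k → O k ≈ (1# + odd k) * O (suc k)
    O-step = tail-step (λ i N<i → odd-vanish i (ℕₚ.<⇒≤ N<i))

    E⁻-step : ∀ k → E⁻ k ≈ (1# + even⁻ k) * E⁻ (suc k)
    E⁻-step = tail-step (λ i N<i → neg-vanish (even-vanish i N<i))

    O⁻-step : ∀ k → O⁻ k ≈ (1# + odd⁻ k) * O⁻ (suc k)
    O⁻-step = tail-step (λ i N<i → neg-vanish (odd-vanish i (ℕₚ.<⇒≤ N<i)))

    E≈1 : ∀ k → N ℕ.< k → E k ≈ 1#
    E≈1 = tail≈1 even-vanish

    O≈1 : ∀ k → N ℕ.< k → O k ≈ 1#
    O≈1 = tail≈1 (λ i N<i → odd-vanish i (ℕₚ.<⇒≤ N<i))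

    E⁻≈1 : ∀ k → N ℕ.< k → E⁻ k ≈ 1#
    E⁻≈1 = tail≈1 (λ i N<i → neg-vanish (even-vanish i N<i))

    O⁻≈1 : ∀ k → N ℕ.< k → O⁻ k ≈ 1#
    O⁻≈1 = tail≈1 (λ i N<i → neg-vanish (odd-vanish i (ℕₚ.<⇒≤ N<i)))

    -- The first factor is 1 - q^0. This makes the telescoping in `H-partial` start from zero.
    E⁻0≈0 : E⁻ 0 ≈ 0#
    E⁻0≈0 = begin
      E⁻ 0                   ≈⟨ E⁻-step 0 ⟩
      (1# + - p 0) * E⁻ 1    ≈⟨ *-congʳ (+-congˡ (-‿cong p-zero)) ⟩
      (1# + - 1#) * E⁻ 1     ≈⟨ *-congʳ (-‿inverseʳ 1#) ⟩
      0# * E⁻ 1              ≈⟨ zeroˡ _ ⟩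
      0# ∎

    -- The functional equations of S_j and H_j, and the partial theta series.

    -- t m stands for (-1)^m q^(m²).
    module _ (t : ℕ → Carrier) (t-zero : t 0 ≈ 1#)
      (t-suc : ∀ m → t (suc m) + t m * odd m ≈ 0#) where

      -- The recurrence at `N` expresses `t (suc N)` through `odd N`, which is already zero. All
      -- boundary terms of sums cut off at `suc N` disappear by this.
      t-vanish : t (suc N) ≈ 0#
      t-vanish = begin
        t (suc N)                 ≈⟨ +-identityʳ _ ⟨
        t (suc N) + 0#            ≈⟨ +-congˡ (zeroʳ (t N)) ⟨
        t (suc N) + t N * 0#      ≈⟨ +-congˡ (*-congˡ (odd-vanish N ℕₚ.≤-refl)) ⟨
        t (suc N) + t N * odd N   ≈⟨ t-suc N ⟩
        0# ∎

      -- The first L terms of S_j. The product E(q^(2m+2j)) begins with the factor 1 + q^(2m+2j+2),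
      -- whence the `suc`.
      S : ℕ → ℕ → Carrier
      S L j = ∑ L (λ m → t m * E (suc (m ℕ.+ j)))

      -- Induction on the number of summands. The second term on the left is what the shift of m by
      -- one leaves at the end of the cut-off sum; it vanishes for `L = suc N`.
      S-partial : ∀ L j → (1# + odd j) * S L j + odd j * (t L * E (suc (L ℕ.+ j)))
                        ≈ S L (suc j) + odd j * E (suc j)
      S-partial zero    j = begin
        (1# + odd j) * 0# + odd j * (t 0 * E (suc j))
          ≈⟨ +-cong (zeroʳ _) (*-congˡ (trans (*-congʳ t-zero) (*-identityˡ _))) ⟩
        0# + odd j * E (suc j) ∎
      S-partial (suc L) j = begin
        (1# + x) * (S L j + t L * E₁) + x * (t (suc L) * E₂)
          ≈⟨ solve 6 (λ x s tl e₁ t′ e₂ →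
               (con 1 :+ x) :* (s :+ tl :* e₁) :+ x :* (t′ :* e₂) :=
               ((con 1 :+ x) :* s :+ x :* (tl :* e₁)) :+ (tl :* e₁ :+ x :* (t′ :* e₂)))
               refl x (S L j) (t L) E₁ (t (suc L)) E₂ ⟩
        ((1# + x) * S L j + x * (t L * E₁)) + (t L * E₁ + x * (t (suc L) * E₂))
          ≈⟨ +-cong (S-partial L j) new ⟩
        (S L (suc j) + x * E (suc j)) + t L * E₂
          ≈⟨ solve 3 (λ a b c → (a :+ b) :+ c := (a :+ c) :+ b) refl _ _ _ ⟩
        (S L (suc j) + t L * E₂) + x * E (suc j)
          ≡⟨ ≡.cong (λ k → (S L (suc j) + t L * E (suc k)) + x * E (suc j)) (≡.sym (ℕₚ.+-suc L j)) ⟩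
        (S L (suc j) + t L * E (suc (L ℕ.+ suc j))) + x * E (suc j) ∎
        where
        x = odd j
        E₁ = E (suc (L ℕ.+ j))
        E₂ = E (suc (suc (L ℕ.+ j)))
        -- `E₁` is `1 + odd L * x` times `E₂`; by `t-suc` the share with `odd L * x` cancels against
        -- `x * (t (suc L) * E₂)`.
        new : t L * E₁ + x * (t (suc L) * E₂) ≈ t L * E₂
        new = begin
          t L * E₁ + x * (t (suc L) * E₂)
            ≈⟨ +-congʳ (*-congˡ (trans (E-step (suc (L ℕ.+ j))) (*-congʳ (+-congˡ (even-suc-+ L j))))) ⟩
          t L * ((1# + odd L * x) * E₂) + x * (t (suc L) * E₂)
            ≈⟨ solve 5 (λ tl y x e t′ → tl :* ((con 1 :+ y :* x) :* e) :+ x :* (t′ :* e) :=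
                 tl :* e :+ x :* e :* (t′ :+ tl :* y)) refl (t L) (odd L) x E₂ (t (suc L)) ⟩
          t L * E₂ + x * E₂ * (t (suc L) + t L * odd L)
            ≈⟨ +-congˡ (trans (*-congˡ (t-suc L)) (zeroʳ _)) ⟩
          t L * E₂ + 0#
            ≈⟨ +-identityʳ _ ⟩
          t L * E₂ ∎

      S-step : ∀ j → (1# + odd j) * S (suc N) j ≈ S (suc N) (suc j) + odd j * E (suc j)
      S-step j = begin
        (1# + odd j) * S (suc N) j
          ≈⟨ +-identityʳ _ ⟨
        (1# + odd j) * S (suc N) j + 0#
          ≈⟨ +-congˡ (trans (*-congˡ (trans (*-congʳ t-vanish) (zeroˡ _))) (zeroʳ _)) ⟨
        (1# + odd j) * S (suc N) j + odd j * (t (suc N) * E (suc (suc N ℕ.+ j)))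
          ≈⟨ S-partial (suc N) j ⟩
        S (suc N) (suc j) + odd j * E (suc j) ∎

      H : ℕ → ℕ → Carrier
      H L j = ∑ L (λ k → even k * (E⁻ (suc k) * O⁻ (k ℕ.+ j)))

      -- Telescoping: with u = q^(2k) and v = q^(2k+2j+1), the k-th summand on the left is
      -- `E⁻ (suc k) * O⁻ (suc (k + j))` times u(1-v) + v = 1 - (1-u)(1-v), a difference of
      -- consecutive values of the right-hand side.
      H-partial : ∀ L j → H L j + odd j * H L (suc j) ≈ E⁻ L * O⁻ (L ℕ.+ j)
      H-partial zero    j = begin
        0# + odd j * 0#   ≈⟨ trans (+-identityˡ _) (zeroʳ _) ⟩
        0#                ≈⟨ zeroˡ _ ⟨
        0# * O⁻ j         ≈⟨ *-congʳ E⁻0≈0 ⟨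
        E⁻ 0 * O⁻ j ∎
      H-partial (suc L) j = begin
        (H L j + u * (E′ * O⁻ (L ℕ.+ j))) + x * (H L (suc j) + u * (E′ * O⁻ (L ℕ.+ suc j)))
          ≡⟨ ≡.cong (λ k → (H L j + u * (E′ * O⁻ (L ℕ.+ j))) + x * (H L (suc j) + u * (E′ * O⁻ k)))
               (ℕₚ.+-suc L j) ⟩
        (H L j + u * (E′ * O⁻ (L ℕ.+ j))) + x * (H L (suc j) + u * (E′ * O′))
          ≈⟨ solve 7 (λ h u e o x h′ o′ →
               (h :+ u :* (e :* o)) :+ x :* (h′ :+ u :* (e :* o′)) :=
               (h :+ x :* h′) :+ (u :* (e :* o) :+ (u :* x) :* (e :* o′)))
               refl (H L j) u E′ (O⁻ (L ℕ.+ j)) x (H L (suc j)) O′ ⟩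
        (H L j + x * H L (suc j)) + (u * (E′ * O⁻ (L ℕ.+ j)) + (u * x) * (E′ * O′))
          ≈⟨ +-cong (H-partial L j) (+-cong (*-congˡ (*-congˡ (O⁻-step _)))
               (*-congʳ (sym (odd-+ L j)))) ⟩
        E⁻ L * O⁻ (L ℕ.+ j) + (u * (E′ * ((1# + v⁻) * O′)) + v * (E′ * O′))
          ≈⟨ +-congʳ (*-cong (E⁻-step L) (O⁻-step _)) ⟩
        ((1# + u⁻) * E′) * ((1# + v⁻) * O′) + (u * (E′ * ((1# + v⁻) * O′)) + v * (E′ * O′))
          -- The semiring solver treats `u` and `u⁻` as unrelated atoms, so the sums `u⁻ + u` and
          -- `v⁻ + v` are collected first and cancelled afterwards.
          ≈⟨ solve 6 (λ u⁻ e v⁻ o u v →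
               ((con 1 :+ u⁻) :* e) :* ((con 1 :+ v⁻) :* o) :+
                 (u :* (e :* ((con 1 :+ v⁻) :* o)) :+ v :* (e :* o)) :=
               e :* o :+ ((v⁻ :+ v) :* (e :* o) :+ (u⁻ :+ u) :* (e :* ((con 1 :+ v⁻) :* o))))
               refl u⁻ E′ v⁻ O′ u v ⟩
        E′ * O′ + ((v⁻ + v) * (E′ * O′) + (u⁻ + u) * (E′ * ((1# + v⁻) * O′)))
          ≈⟨ +-congˡ (+-cong (trans (*-congʳ (-‿inverseˡ v)) (zeroˡ _))
               (trans (*-congʳ (-‿inverseˡ u)) (zeroˡ _))) ⟩
        E′ * O′ + (0# + 0#)
          ≈⟨ trans (+-congˡ (+-identityˡ 0#)) (+-identityʳ _) ⟩
        E′ * O′ ∎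
        where
        u = even L
        u⁻ = even⁻ L
        v = odd (L ℕ.+ j)
        v⁻ = odd⁻ (L ℕ.+ j)
        x = odd j
        E′ = E⁻ (suc L)
        O′ = O⁻ (suc (L ℕ.+ j))

      H-step : ∀ j → H (suc N) j + odd j * H (suc N) (suc j) ≈ 1#
      H-step j = begin
        H (suc N) j + odd j * H (suc N) (suc j)   ≈⟨ H-partial (suc N) j ⟩
        E⁻ (suc N) * O⁻ (suc N ℕ.+ j)             ≈⟨ *-cong (E⁻≈1 (suc N) ℕₚ.≤-refl) (O⁻≈1 _ (ℕₚ.m≤m+n (suc N) j)) ⟩
        1# * 1#                                   ≈⟨ *-identityˡ 1# ⟩
        1# ∎

      -- Iterating H_j = 1 - q^(2j+1) H_(j+1): each round contributes one term of the theta series,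
      -- and its sign and power accumulate in `t J`.
      H-theta-partial : ∀ J → H (suc N) 0 ≈ ∑ J t + t J * H (suc N) J
      H-theta-partial zero    = sym (trans (+-identityˡ _) (trans (*-congʳ t-zero) (*-identityˡ _)))
      H-theta-partial (suc J) = begin
        H (suc N) 0
          ≈⟨ H-theta-partial J ⟩
        ∑ J t + t J * H (suc N) J
          ≈⟨ +-congˡ (+-identityʳ _) ⟨
        ∑ J t + (t J * H (suc N) J + 0#)
          -- The added zero is `t-suc J` times H_(J+1); it supplies both the missing half of
          -- `H-step J` and the next remainder.
          ≈⟨ +-congˡ (+-congˡ (trans (*-congʳ (t-suc J)) (zeroˡ _))) ⟨
        ∑ J t + (t J * H (suc N) J + (t (suc J) + t J * odd J) * H (suc N) (suc J))
          ≈⟨ solve 6 (λ s t h t′ x h′ → s :+ (t :* h :+ (t′ :+ t :* x) :* h′) :=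
               s :+ t :* (h :+ x :* h′) :+ t′ :* h′)
               refl (∑ J t) (t J) (H (suc N) J) (t (suc J)) (odd J) (H (suc N) (suc J)) ⟩
        ∑ J t + t J * (H (suc N) J + odd J * H (suc N) (suc J)) + t (suc J) * H (suc N) (suc J)
          ≈⟨ +-congʳ (+-congˡ (trans (*-congˡ (H-step J)) (*-identityʳ _))) ⟩
        ∑ J t + t J + t (suc J) * H (suc N) (suc J) ∎

      H-theta : H (suc N) 0 ≈ ∑ (suc N) t
      H-theta = begin
        H (suc N) 0                                       ≈⟨ H-theta-partial (suc N) ⟩
        ∑ (suc N) t + t (suc N) * H (suc N) (suc N)       ≈⟨ +-congˡ (trans (*-congʳ t-vanish) (zeroˡ _)) ⟩
        ∑ (suc N) t + 0#                                  ≈⟨ +-identityʳ _ ⟩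
        ∑ (suc N) t ∎

      -- Comparison with the generating functions of the partitions.

      -- e₀ n and e₁ n stand for the generating functions of the partitions into
      -- distinct parts ≤ n with odd smallest part, for an even and an odd number of parts.
      module _ (e₀ e₁ : ℕ → Carrier) (e₀-zero : e₀ 0 ≈ 0#) (e₁-zero : e₁ 0 ≈ 0#)
        (e₀-suc : ∀ n → e₀ (suc n) ≈ e₀ n + p (suc n) * e₁ n)
        (e₁-odd : ∀ j → e₁ (1 ℕ.+ 2 ℕ.* j) ≈ e₁ (2 ℕ.* j) + odd j * e₀ (2 ℕ.* j) + odd j)
        (e₁-even : ∀ j → e₁ (2 ℕ.+ 2 ℕ.* j) ≈
          e₁ (1 ℕ.+ 2 ℕ.* j) + p (2 ℕ.+ 2 ℕ.* j) * e₀ (1 ℕ.+ 2 ℕ.* j))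
        where

        2*suc : ∀ (f : ℕ → Carrier) j → f (2 ℕ.* suc j) ≈ f (2 ℕ.+ 2 ℕ.* j)
        2*suc f j = reflexive (≡.cong f (ℕₚ.*-suc 2 j))

        e₀-even′ : ∀ j → e₀ (2 ℕ.* suc j) ≈ e₀ (1 ℕ.+ 2 ℕ.* j) + even (suc j) * e₁ (1 ℕ.+ 2 ℕ.* j)
        e₀-even′ j = trans (2*suc e₀ j) (trans (e₀-suc _) (+-congˡ (*-congʳ (sym (2*suc p j)))))

        e₁-even′ : ∀ j → e₁ (2 ℕ.* suc j) ≈ e₁ (1 ℕ.+ 2 ℕ.* j) + even (suc j) * e₀ (1 ℕ.+ 2 ℕ.* j)
        e₁-even′ j = trans (2*suc e₁ j) (trans (e₁-even j) (+-congˡ (*-congʳ (sym (2*suc p j)))))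

        -- Both parities together: all partitions into distinct parts at most n with odd smallest
        -- part.
        a : ℕ → Carrier
        a n = e₀ n + e₁ n

        -- The part 2j+1 may join any earlier partition or stand alone; the part 2j+2 may only join,
        -- so it merely contributes a factor.
        a-step : ∀ j → a (2 ℕ.* suc j) ≈ (1# + even (suc j)) * ((1# + odd j) * a (2 ℕ.* j) + odd j)
        a-step j = begin
          a (2 ℕ.* suc j)
            ≈⟨ +-cong (e₀-even′ j) (e₁-even′ j) ⟩
          (e₀ (1 ℕ.+ 2 ℕ.* j) + u * e₁ (1 ℕ.+ 2 ℕ.* j)) + (e₁ (1 ℕ.+ 2 ℕ.* j) + u * e₀ (1 ℕ.+ 2 ℕ.* j))
            ≈⟨ solve 3 (λ e₀ e₁ u → (e₀ :+ u :* e₁) :+ (e₁ :+ u :* e₀) :=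
                 (con 1 :+ u) :* (e₀ :+ e₁)) refl _ _ u ⟩
          (1# + u) * a (1 ℕ.+ 2 ℕ.* j)
            ≈⟨ *-congˡ (+-cong (e₀-suc _) (e₁-odd j)) ⟩
          (1# + u) * ((e₀ (2 ℕ.* j) + v * e₁ (2 ℕ.* j)) + (e₁ (2 ℕ.* j) + v * e₀ (2 ℕ.* j) + v))
            ≈⟨ solve 4 (λ e₀ e₁ u v → (con 1 :+ u) :* ((e₀ :+ v :* e₁) :+ (e₁ :+ v :* e₀ :+ v)) :=
                 (con 1 :+ u) :* ((con 1 :+ v) :* (e₀ :+ e₁) :+ v)) refl _ _ u v ⟩
          (1# + u) * ((1# + v) * a (2 ℕ.* j) + v) ∎
          where
          u = even (suc j)
          v = odd j

        a-zero : a 0 ≈ 0#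
        a-zero = trans (+-cong e₀-zero e₁-zero) (+-identityˡ 0#)

        -- The product of `O j`, `a (2j)` and `E (suc j)` generates the partitions into distinct
        -- parts whose smallest part is odd and below 2j. One step moves the factor 1 + q^(2j+1)
        -- from `O j` into `S-step`, which releases those with smallest part 2j+1.
        OS-invariant : ∀ j → O 0 * S (suc N) 0 ≈ O j * (S (suc N) j + a (2 ℕ.* j) * E (suc j))
        OS-invariant zero = *-congˡ (sym (trans (+-congˡ (trans (*-congʳ a-zero) (zeroˡ _))) (+-identityʳ _)))
        OS-invariant (suc j) = begin
          O 0 * S (suc N) 0
            ≈⟨ OS-invariant j ⟩
          O j * (S (suc N) j + a (2 ℕ.* j) * E (suc j))
            ≈⟨ *-congʳ (O-step j) ⟩
          (1# + v) * O (suc j) * (S (suc N) j + a (2 ℕ.* j) * E (suc j))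
            ≈⟨ solve 5 (λ v o s a e → (con 1 :+ v) :* o :* (s :+ a :* e) :=
                 o :* ((con 1 :+ v) :* s :+ (con 1 :+ v) :* a :* e)) refl v (O (suc j)) _ _ (E (suc j)) ⟩
          O (suc j) * ((1# + v) * S (suc N) j + (1# + v) * a (2 ℕ.* j) * E (suc j))
            ≈⟨ *-congˡ (+-congʳ (S-step j)) ⟩
          O (suc j) * ((S (suc N) (suc j) + v * E (suc j)) + (1# + v) * a (2 ℕ.* j) * E (suc j))
            ≈⟨ *-congˡ (solve 4 (λ s v e a → (s :+ v :* e) :+ (con 1 :+ v) :* a :* e :=
                 s :+ ((con 1 :+ v) :* a :+ v) :* e) refl _ v (E (suc j)) _) ⟩
          O (suc j) * (S (suc N) (suc j) + ((1# + v) * a (2 ℕ.* j) + v) * E (suc j))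
            ≈⟨ *-congˡ (+-congˡ (*-congˡ (E-step (suc j)))) ⟩
          O (suc j) * (S (suc N) (suc j) + ((1# + v) * a (2 ℕ.* j) + v) * ((1# + u) * E (suc (suc j))))
            ≈⟨ *-congˡ (+-congˡ (solve 3 (λ x y z → x :* (y :* z) := y :* x :* z) refl _ (1# + u) _)) ⟩
          O (suc j) * (S (suc N) (suc j) + (1# + u) * ((1# + v) * a (2 ℕ.* j) + v) * E (suc (suc j)))
            ≈⟨ *-congˡ (+-congˡ (*-congʳ (a-step j))) ⟨
          O (suc j) * (S (suc N) (suc j) + a (2 ℕ.* suc j) * E (suc (suc j))) ∎
          where
          u = even (suc j)
          v = odd j

        -- This is 1 plus the generating function of the partitions with parts at most 2j weighted
        -- by (-1)^(number of parts). Thanks to the 1, the part 2j+1 acts as the factor 1 -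
        -- q^(2j+1); since 2j+2 cannot stand alone, its factor needs the correction + q^(2j+2).
        h : ℕ → Carrier
        h zero    = 1#
        h (suc j) = (1# + even⁻ (suc j)) * ((1# + odd⁻ j) * h j) + even (suc j)

        -- The relation h = 1 + e₀ - e₁ without subtraction. A new largest part exchanges the two
        -- parities, as the sign in the recursion of `h` does.
        h-excess : ∀ j → h j + e₁ (2 ℕ.* j) ≈ 1# + e₀ (2 ℕ.* j)
        h-excess zero    = +-congˡ (trans e₁-zero (sym e₀-zero))
        h-excess (suc j) = begin
          ((1# + u⁻) * h′ + u) + e₁ (2 ℕ.* suc j)
            ≈⟨ +-congˡ (e₁-even′ j) ⟩
          ((1# + u⁻) * h′ + u) + (y + u * x)
            ≈⟨ solve 5 (λ u⁻ h′ u y x → ((con 1 :+ u⁻) :* h′ :+ u) :+ (y :+ u :* x) :=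
                 (h′ :+ y) :+ u :* (con 1 :+ x) :+ u⁻ :* h′) refl u⁻ h′ u y x ⟩
          (h′ + y) + u * (1# + x) + u⁻ * h′
            -- The same equation is used in both directions, so that `u * h′` appears and cancels
            -- against `u⁻ * h′`.
            ≈⟨ +-congʳ (+-cong h′-excess (*-congˡ (sym h′-excess))) ⟩
          (1# + x) + u * (h′ + y) + u⁻ * h′
            ≈⟨ solve 5 (λ u⁻ h′ u y x → (con 1 :+ x) :+ u :* (h′ :+ y) :+ u⁻ :* h′ :=
                 con 1 :+ (x :+ u :* y) :+ (u⁻ :+ u) :* h′) refl u⁻ h′ u y x ⟩
          1# + (x + u * y) + (u⁻ + u) * h′
            ≈⟨ +-cong (+-congˡ (sym (e₀-even′ j))) (trans (*-congʳ (-‿inverseˡ u)) (zeroˡ _)) ⟩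
          1# + e₀ (2 ℕ.* suc j) + 0#
            ≈⟨ +-identityʳ _ ⟩
          1# + e₀ (2 ℕ.* suc j) ∎
          where
          u = even (suc j)
          u⁻ = even⁻ (suc j)
          v = odd j
          v⁻ = odd⁻ j
          h′ = (1# + v⁻) * h j
          x = e₀ (1 ℕ.+ 2 ℕ.* j)
          y = e₁ (1 ℕ.+ 2 ℕ.* j)
          h′-excess : h′ + y ≈ 1# + x
          h′-excess = begin
            h′ + y
              ≈⟨ +-congˡ (e₁-odd j) ⟩
            (1# + v⁻) * h j + (e₁ (2 ℕ.* j) + v * e₀ (2 ℕ.* j) + v)
              ≈⟨ solve 5 (λ v⁻ h e₁ v e₀ → (con 1 :+ v⁻) :* h :+ (e₁ :+ v :* e₀ :+ v) :=
                   (h :+ e₁) :+ v :* (con 1 :+ e₀) :+ v⁻ :* h) refl v⁻ (h j) _ v _ ⟩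
            (h j + e₁ (2 ℕ.* j)) + v * (1# + e₀ (2 ℕ.* j)) + v⁻ * h j
              ≈⟨ +-congʳ (+-cong (h-excess j) (*-congˡ (sym (h-excess j)))) ⟩
            (1# + e₀ (2 ℕ.* j)) + v * (h j + e₁ (2 ℕ.* j)) + v⁻ * h j
              ≈⟨ solve 5 (λ v⁻ h e₁ v e₀ → (con 1 :+ e₀) :+ v :* (h :+ e₁) :+ v⁻ :* h :=
                   con 1 :+ (e₀ :+ v :* e₁) :+ (v⁻ :+ v) :* h) refl v⁻ (h j) _ v _ ⟩
            1# + (e₀ (2 ℕ.* j) + v * e₁ (2 ℕ.* j)) + (v⁻ + v) * h j
              ≈⟨ +-cong (+-congˡ (sym (e₀-suc _))) (trans (*-congʳ (-‿inverseˡ v)) (zeroˡ _)) ⟩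
            1# + x + 0#
              ≈⟨ +-identityʳ _ ⟩
            1# + x ∎

        -- The two tails hold the factors not yet used by `h j`. Each recursion step consumes one
        -- factor of either tail, and its correction term becomes the next summand of H_0.
        h-tail : ∀ j → h j * (E⁻ (suc j) * O⁻ j) ≈ H (suc j) 0
        h-tail zero    = begin
          1# * (E⁻ 1 * O⁻ 0)            ≈⟨ *-congʳ p-zero ⟨
          even 0 * (E⁻ 1 * O⁻ 0)        ≈⟨ +-identityˡ _ ⟨
          0# + even 0 * (E⁻ 1 * O⁻ 0) ∎
        h-tail (suc j) = begin
          ((1# + u⁻) * ((1# + v⁻) * h j) + u) * (E⁻ (suc (suc j)) * O⁻ (suc j))
            ≈⟨ solve 6 (λ u⁻ v⁻ h u e o →
                 ((con 1 :+ u⁻) :* ((con 1 :+ v⁻) :* h) :+ u) :* (e :* o) :=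
                 h :* (((con 1 :+ u⁻) :* e) :* ((con 1 :+ v⁻) :* o)) :+ u :* (e :* o))
                 refl u⁻ v⁻ (h j) u (E⁻ (suc (suc j))) (O⁻ (suc j)) ⟩
          h j * (((1# + u⁻) * E⁻ (suc (suc j))) * ((1# + v⁻) * O⁻ (suc j)))
            + u * (E⁻ (suc (suc j)) * O⁻ (suc j))
            ≈⟨ +-congʳ (*-congˡ (*-cong (E⁻-step (suc j)) (O⁻-step j))) ⟨
          h j * (E⁻ (suc j) * O⁻ j) + u * (E⁻ (suc (suc j)) * O⁻ (suc j))
            ≈⟨ +-congʳ (h-tail j) ⟩
          H (suc j) 0 + u * (E⁻ (suc (suc j)) * O⁻ (suc j))
            ≡⟨ ≡.cong (λ k → H (suc j) 0 + u * (E⁻ (suc (suc j)) * O⁻ k)) (≡.sym (ℕₚ.+-identityʳ (suc j))) ⟩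
          H (suc j) 0 + u * (E⁻ (suc (suc j)) * O⁻ (suc j ℕ.+ 0)) ∎
          where
          u = even (suc j)
          u⁻ = even⁻ (suc j)
          v⁻ = odd⁻ j

        h-theta : h (suc N) ≈ ∑ (suc N) t
        h-theta = begin
          h (suc N)
            ≈⟨ *-identityʳ _ ⟨
          h (suc N) * 1#
            ≈⟨ *-congˡ (trans (*-cong (E⁻≈1 _ (ℕₚ.n≤1+n (suc N))) (O⁻≈1 _ ℕₚ.≤-refl)) (*-identityˡ 1#)) ⟨
          h (suc N) * (E⁻ (suc (suc N)) * O⁻ (suc N))
            ≈⟨ h-tail (suc N) ⟩
          H (suc N) 0 + even (suc N) * _
            -- `h (suc N)` reaches one summand beyond `H (suc N) 0`; that summand carries q^(2N+2) =
            -- 0.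
            ≈⟨ +-congˡ (trans (*-congʳ (even-vanish (suc N) ℕₚ.≤-refl)) (zeroˡ _)) ⟩
          H (suc N) 0 + 0#
            ≈⟨ +-identityʳ _ ⟩
          H (suc N) 0
            ≈⟨ H-theta ⟩
          ∑ (suc N) t ∎

        -- Past index N every product `E` is 1, and only the theta coefficients remain.
        S-last : S (suc N) (suc N) ≈ ∑ (suc N) t
        S-last = ∑-cong (suc N) (λ m → trans (*-congˡ (E≈1 _ (ℕ.s≤s (ℕₚ.≤-trans (ℕₚ.n≤1+n N) (ℕₚ.m≤n+m (suc N) m)))))
                                  (*-identityʳ _))

        -- At `j = suc N` the theta remainder is 1 + e₀ - e₁ and the peeled-off part is e₀ + e₁.
        OS≈1+2e₀ : O 0 * S (suc N) 0 ≈ 1# + (e₀ (2 ℕ.* suc N) + e₀ (2 ℕ.* suc N))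
        OS≈1+2e₀ = begin
          O 0 * S (suc N) 0
            ≈⟨ OS-invariant (suc N) ⟩
          O (suc N) * (S (suc N) (suc N) + a M * E (suc (suc N)))
            ≈⟨ trans (*-congʳ (O≈1 (suc N) ℕₚ.≤-refl)) (*-identityˡ _) ⟩
          S (suc N) (suc N) + a M * E (suc (suc N))
            ≈⟨ +-cong (trans S-last (sym h-theta)) (trans (*-congˡ (E≈1 _ (ℕₚ.n≤1+n (suc N)))) (*-identityʳ _)) ⟩
          h (suc N) + (e₀ M + e₁ M)
            ≈⟨ solve 3 (λ h e₀ e₁ → h :+ (e₀ :+ e₁) := (h :+ e₁) :+ e₀) refl _ _ _ ⟩
          (h (suc N) + e₁ M) + e₀ M
            ≈⟨ +-congʳ (h-excess (suc N)) ⟩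
          1# + e₀ M + e₀ M
            ≈⟨ +-assoc _ _ _ ⟩
          1# + (e₀ M + e₀ M) ∎
          where
          M = 2 ℕ.* suc N

        -- From the sum with denominators to S_0.

        -- I m stands for 1 / (-q²;q²)_m.
        module _ (I : ℕ → Carrier) (I-inverse : ∀ m → I m * ∏ m (λ j → 1# + p (2 ℕ.+ 2 ℕ.* j)) ≈ 1#) where

          E-split : ∀ m → E 1 ≈ ∏ m (λ j → 1# + p (2 ℕ.+ 2 ℕ.* j)) * E (suc m)
          E-split zero    = sym (*-identityˡ _)
          E-split (suc m) = begin
            E 1                                                    ≈⟨ E-split m ⟩
            ∏ m _ * E (suc m)                                      ≈⟨ *-congˡ (E-step (suc m)) ⟩
            ∏ m _ * ((1# + even (suc m)) * E (suc (suc m)))        ≈⟨ *-assoc _ _ _ ⟨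
            ∏ m _ * (1# + even (suc m)) * E (suc (suc m))          ≈⟨ *-congʳ (*-congˡ (+-congˡ (2*suc p m))) ⟩
            ∏ m _ * (1# + p (2 ℕ.+ 2 ℕ.* m)) * E (suc (suc m)) ∎

          -- Dividing (-q²;q²)_∞ by its first m factors leaves the tail that occurs in S_0.
          E*I : ∀ m → E 1 * I m ≈ E (suc m)
          E*I m = begin
            E 1 * I m                     ≈⟨ *-congʳ (E-split m) ⟩
            ∏ m _ * E (suc m) * I m       ≈⟨ solve 3 (λ x y z → x :* y :* z := (z :* x) :* y) refl _ _ _ ⟩
            (I m * ∏ m _) * E (suc m)     ≈⟨ *-congʳ (I-inverse m) ⟩
            1# * E (suc m)                ≈⟨ *-identityˡ _ ⟩
            E (suc m) ∎

          mock-theta : ∏ (suc N ℕ.+ suc N) (λ k → 1# + p (suc k)) * ∑ (suc N) (λ m → t m * I m)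
                     ≈ 1# + (e₀ (2 ℕ.* suc N) + e₀ (2 ℕ.* suc N))
          mock-theta = begin
            ∏ (suc N ℕ.+ suc N) (λ k → 1# + p (suc k)) * ∑ (suc N) (λ m → t m * I m)
              -- With 2N+2 factors, each parity class has exactly the `suc N` factors of a `tail`.
              ≈⟨ *-congʳ (∏-pairs (suc N) _) ⟩
            O 0 * ∏ (suc N) (λ i → 1# + p (2 ℕ.+ 2 ℕ.* i)) * ∑ (suc N) (λ m → t m * I m)
              ≈⟨ *-congʳ (*-congˡ (∏-cong (suc N) (λ i → +-congˡ (2*suc p i)))) ⟨
            O 0 * E 1 * ∑ (suc N) (λ m → t m * I m)
              ≈⟨ *-assoc _ _ _ ⟩
            O 0 * (E 1 * ∑ (suc N) (λ m → t m * I m))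
              ≈⟨ *-congˡ (*-distribˡ-∑ (E 1) (suc N) _) ⟩
            O 0 * ∑ (suc N) (λ m → E 1 * (t m * I m))
              ≈⟨ *-congˡ (∑-cong (suc N) term) ⟩
            O 0 * S (suc N) 0
              ≈⟨ OS≈1+2e₀ ⟩
            1# + (e₀ (2 ℕ.* suc N) + e₀ (2 ℕ.* suc N)) ∎
            where
            term : ∀ m → E 1 * (t m * I m) ≈ t m * E (suc (m ℕ.+ 0))
            term m = begin
              E 1 * (t m * I m)         ≈⟨ solve 3 (λ x y z → x :* (y :* z) := y :* (x :* z)) refl _ _ _ ⟩
              t m * (E 1 * I m)         ≈⟨ *-congˡ (E*I m) ⟩
              t m * E (suc m)           ≡⟨ ≡.cong (λ k → t m * E (suc k)) (≡.sym (ℕₚ.+-identityʳ m)) ⟩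
              t m * E (suc (m ℕ.+ 0)) ∎

open import Data.Bool using (Bool; true; false; not)
open import Data.Integer as ℤ using (ℤ; +_; -_)
import Data.Integer.Properties as ℤₚ
import Data.Integer.Tactic.RingSolver as ℤ-Solver
open import Data.List using (List; []; _∷_; [_]; _∷ʳ_; _++_; map; upTo; applyUpTo; zipWith; length; foldr; last)
open import Data.List.Membership.Propositional using (_∈_)
open import Data.List.Membership.Propositional.Properties using (∈-++⁻; ∈-++⁺ˡ; ∈-++⁺ʳ; ∈-map⁻; ∈-map⁺)
open import Data.List.Properties using (length-++; length-map; map-++; map-applyUpTo; map-upTo; upTo-∷ʳ; ∷-injectiveʳ)
open import Data.List.Relation.Unary.All as All using (All; []; _∷_)
open import Data.List.Relation.Unary.AllPairs using ([]; _∷_)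
open import Data.List.Relation.Unary.Any using (here)
open import Data.List.Relation.Unary.Linked as Linked using (Linked; []; [-]; _∷_)
open import Data.List.Relation.Unary.Linked.Properties using (Linked⇒AllPairs)
open import Data.List.Relation.Unary.Unique.Propositional using (Unique)
import Data.List.Relation.Unary.Unique.Propositional.Properties as Uniqueₚ
open import Data.Maybe using (just)
open import Data.Maybe.Properties using (just-injective)
open import Data.Nat.DivMod using ([m+kn]%n≡m%n)
import Data.Nat.Tactic.RingSolver as ℕ-Solver
open import Data.Product using (Σ; ∃; _×_; _,_; proj₁; proj₂)
open import Data.Sum using (inj₁; inj₂)
open import Function using (_∘_; flip)
open import Function.Bundles using (_⇔_; mk⇔)
open import Level using (0ℓ)
open import Relation.Nullary using (¬_; yes; no; contradiction)
open ≡ using (refl; sym; trans; cong; cong₂; subst; module ≡-Reasoning)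

-- Integer power series as a ring modulo q^(N+1).

shift : Series → Series
shift f n = f (suc n)

zeroS : Series
zeroS _ = + 0

-S_ : Series → Series
(-S f) n = - f n

*S-zero : ∀ f g → (f *S g) 0 ≡ f 0 ℤ.* g 0
*S-zero f g = ℤₚ.+-identityʳ (f 0 ℤ.* g 0)

-- From f = f(0) + q · `shift f`. The ring laws below follow from this recursion by induction on the
-- degree, without handling the list in the convolution.
*S-suc : ∀ f g n → (f *S g) (suc n) ≡ f 0 ℤ.* g (suc n) ℤ.+ (shift f *S g) n
*S-suc f g n = cong (λ xs → f 0 ℤ.* g (suc n) ℤ.+ sumℤ xs) (begin
  map (λ i → f i ℤ.* g (suc n ℕ.∸ i)) (applyUpTo suc (suc n))
    ≡⟨ map-applyUpTo suc (λ i → f i ℤ.* g (suc n ℕ.∸ i)) (suc n) ⟩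
  applyUpTo (λ i → f (suc i) ℤ.* g (n ℕ.∸ i)) (suc n)
    ≡⟨ map-upTo (λ i → f (suc i) ℤ.* g (n ℕ.∸ i)) (suc n) ⟨
  map (λ i → f (suc i) ℤ.* g (n ℕ.∸ i)) (upTo (suc n)) ∎)
  where open ≡-Reasoning

*S-suc′ : ∀ f g n → (f *S g) (suc n) ≡ f (suc n) ℤ.* g 0 ℤ.+ (f *S shift g) n
*S-suc′ f g zero = begin
  (f *S g) 1                                           ≡⟨ *S-suc f g 0 ⟩
  f 0 ℤ.* g 1 ℤ.+ (shift f *S g) 0                     ≡⟨ cong (ℤ._+_ (f 0 ℤ.* g 1)) (*S-zero (shift f) g) ⟩
  f 0 ℤ.* g 1 ℤ.+ f 1 ℤ.* g 0                          ≡⟨ ℤₚ.+-comm (f 0 ℤ.* g 1) _ ⟩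
  f 1 ℤ.* g 0 ℤ.+ f 0 ℤ.* g 1                          ≡⟨ cong (ℤ._+_ (f 1 ℤ.* g 0)) (*S-zero f (shift g)) ⟨
  f 1 ℤ.* g 0 ℤ.+ (f *S shift g) 0 ∎
  where open ≡-Reasoning
*S-suc′ f g (suc n) = begin
  (f *S g) (2 ℕ.+ n)
    ≡⟨ *S-suc f g (suc n) ⟩
  f 0 ℤ.* g (2 ℕ.+ n) ℤ.+ (shift f *S g) (suc n)
    ≡⟨ cong (ℤ._+_ (f 0 ℤ.* g (2 ℕ.+ n))) (*S-suc′ (shift f) g n) ⟩
  f 0 ℤ.* g (2 ℕ.+ n) ℤ.+ (f (2 ℕ.+ n) ℤ.* g 0 ℤ.+ (shift f *S shift g) n)
    ≡⟨ exchange (f 0 ℤ.* g (2 ℕ.+ n)) (f (2 ℕ.+ n) ℤ.* g 0) _ ⟩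
  f (2 ℕ.+ n) ℤ.* g 0 ℤ.+ (f 0 ℤ.* g (2 ℕ.+ n) ℤ.+ (shift f *S shift g) n)
    ≡⟨ cong (ℤ._+_ (f (2 ℕ.+ n) ℤ.* g 0)) (*S-suc f (shift g) n) ⟨
  f (2 ℕ.+ n) ℤ.* g 0 ℤ.+ (f *S shift g) (suc n) ∎
  where
  open ≡-Reasoning
  exchange : ∀ x y z → x ℤ.+ (y ℤ.+ z) ≡ y ℤ.+ (x ℤ.+ z)
  exchange = ℤ-Solver.solve-∀

*S-comm : ∀ f g n → (f *S g) n ≡ (g *S f) n
*S-comm f g zero = begin
  (f *S g) 0       ≡⟨ *S-zero f g ⟩
  f 0 ℤ.* g 0      ≡⟨ ℤₚ.*-comm (f 0) (g 0) ⟩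
  g 0 ℤ.* f 0      ≡⟨ *S-zero g f ⟨
  (g *S f) 0 ∎
  where open ≡-Reasoning
*S-comm f g (suc n) = begin
  (f *S g) (suc n)                               ≡⟨ *S-suc f g n ⟩
  f 0 ℤ.* g (suc n) ℤ.+ (shift f *S g) n         ≡⟨ cong₂ ℤ._+_ (ℤₚ.*-comm (f 0) _) (*S-comm (shift f) g n) ⟩
  g (suc n) ℤ.* f 0 ℤ.+ (g *S shift f) n         ≡⟨ *S-suc′ g f n ⟨
  (g *S f) (suc n) ∎
  where open ≡-Reasoning

-- Coefficients beyond n never enter; hence equality up to degree `N` is compatible with
-- multiplication.
*S-cong : ∀ n {f f′ g g′} → (∀ i → i ℕ.≤ n → f i ≡ f′ i) → (∀ i → i ℕ.≤ n → g i ≡ g′ i) →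
          (f *S g) n ≡ (f′ *S g′) n
*S-cong zero f≡ g≡ = cong₂ (λ x y → x ℤ.* y ℤ.+ + 0) (f≡ 0 z≤n) (g≡ 0 z≤n)
*S-cong (suc n) {f} {f′} {g} {g′} f≡ g≡ = begin
  (f *S g) (suc n)
    ≡⟨ *S-suc f g n ⟩
  f 0 ℤ.* g (suc n) ℤ.+ (shift f *S g) n
    ≡⟨ cong₂ ℤ._+_ (cong₂ ℤ._*_ (f≡ 0 z≤n) (g≡ (suc n) ℕₚ.≤-refl))
         (*S-cong n (λ i i≤n → f≡ (suc i) (s≤s i≤n)) (λ i i≤n → g≡ i (ℕₚ.m≤n⇒m≤1+n i≤n))) ⟩
  f′ 0 ℤ.* g′ (suc n) ℤ.+ (shift f′ *S g′) n
    ≡⟨ *S-suc f′ g′ n ⟨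
  (f′ *S g′) (suc n) ∎
  where open ≡-Reasoning

*S-distribʳ : ∀ h f g n → ((f +S g) *S h) n ≡ (f *S h) n ℤ.+ (g *S h) n
*S-distribʳ h f g zero = begin
  ((f +S g) *S h) 0                     ≡⟨ *S-zero (f +S g) h ⟩
  (f 0 ℤ.+ g 0) ℤ.* h 0                 ≡⟨ ℤₚ.*-distribʳ-+ (h 0) (f 0) (g 0) ⟩
  f 0 ℤ.* h 0 ℤ.+ g 0 ℤ.* h 0           ≡⟨ cong₂ ℤ._+_ (*S-zero f h) (*S-zero g h) ⟨
  (f *S h) 0 ℤ.+ (g *S h) 0 ∎
  where open ≡-Reasoning
*S-distribʳ h f g (suc n) = begin
  ((f +S g) *S h) (suc n)
    ≡⟨ *S-suc (f +S g) h n ⟩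
  (f 0 ℤ.+ g 0) ℤ.* h (suc n) ℤ.+ ((shift f +S shift g) *S h) n
    ≡⟨ cong (ℤ._+_ ((f 0 ℤ.+ g 0) ℤ.* h (suc n))) (*S-distribʳ h (shift f) (shift g) n) ⟩
  (f 0 ℤ.+ g 0) ℤ.* h (suc n) ℤ.+ ((shift f *S h) n ℤ.+ (shift g *S h) n)
    ≡⟨ regroup (f 0) (g 0) (h (suc n)) _ _ ⟩
  (f 0 ℤ.* h (suc n) ℤ.+ (shift f *S h) n) ℤ.+ (g 0 ℤ.* h (suc n) ℤ.+ (shift g *S h) n)
    ≡⟨ cong₂ ℤ._+_ (*S-suc f h n) (*S-suc g h n) ⟨
  (f *S h) (suc n) ℤ.+ (g *S h) (suc n) ∎
  where
  open ≡-Reasoning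
  regroup : ∀ a b c x y → (a ℤ.+ b) ℤ.* c ℤ.+ (x ℤ.+ y) ≡ (a ℤ.* c ℤ.+ x) ℤ.+ (b ℤ.* c ℤ.+ y)
  regroup = ℤ-Solver.solve-∀

-- Associativity needs this, since `shift (f *S g)` contains the scalar multiple f(0) · `shift g`.
*S-scaleˡ : ∀ c f g n → ((λ i → c ℤ.* f i) *S g) n ≡ c ℤ.* (f *S g) n
*S-scaleˡ c f g zero = begin
  ((λ i → c ℤ.* f i) *S g) 0   ≡⟨ *S-zero (λ i → c ℤ.* f i) g ⟩
  c ℤ.* f 0 ℤ.* g 0            ≡⟨ ℤₚ.*-assoc c (f 0) (g 0) ⟩
  c ℤ.* (f 0 ℤ.* g 0)          ≡⟨ cong (c ℤ.*_) (*S-zero f g) ⟨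
  c ℤ.* (f *S g) 0 ∎
  where open ≡-Reasoning
*S-scaleˡ c f g (suc n) = begin
  ((λ i → c ℤ.* f i) *S g) (suc n)
    ≡⟨ *S-suc (λ i → c ℤ.* f i) g n ⟩
  c ℤ.* f 0 ℤ.* g (suc n) ℤ.+ ((λ i → c ℤ.* shift f i) *S g) n
    ≡⟨ cong (ℤ._+_ (c ℤ.* f 0 ℤ.* g (suc n))) (*S-scaleˡ c (shift f) g n) ⟩
  c ℤ.* f 0 ℤ.* g (suc n) ℤ.+ c ℤ.* (shift f *S g) n
    ≡⟨ factor c (f 0) (g (suc n)) _ ⟩
  c ℤ.* (f 0 ℤ.* g (suc n) ℤ.+ (shift f *S g) n)
    ≡⟨ cong (c ℤ.*_) (*S-suc f g n) ⟨
  c ℤ.* (f *S g) (suc n) ∎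
  where
  open ≡-Reasoning
  factor : ∀ c x y z → c ℤ.* x ℤ.* y ℤ.+ c ℤ.* z ≡ c ℤ.* (x ℤ.* y ℤ.+ z)
  factor = ℤ-Solver.solve-∀

*S-assoc : ∀ f g h n → ((f *S g) *S h) n ≡ (f *S (g *S h)) n
*S-assoc f g h zero = begin
  ((f *S g) *S h) 0            ≡⟨ *S-zero (f *S g) h ⟩
  (f *S g) 0 ℤ.* h 0           ≡⟨ cong (ℤ._* h 0) (*S-zero f g) ⟩
  f 0 ℤ.* g 0 ℤ.* h 0          ≡⟨ ℤₚ.*-assoc (f 0) (g 0) (h 0) ⟩
  f 0 ℤ.* (g 0 ℤ.* h 0)        ≡⟨ cong (f 0 ℤ.*_) (*S-zero g h) ⟨
  f 0 ℤ.* (g *S h) 0           ≡⟨ *S-zero f (g *S h) ⟨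
  (f *S (g *S h)) 0 ∎
  where open ≡-Reasoning
*S-assoc f g h (suc n) = begin
  ((f *S g) *S h) (suc n)
    ≡⟨ *S-suc (f *S g) h n ⟩
  (f *S g) 0 ℤ.* h (suc n) ℤ.+ (shift (f *S g) *S h) n
    ≡⟨ cong₂ (λ x y → x ℤ.* h (suc n) ℤ.+ y) (*S-zero f g)
         (*S-cong n {g = h} (λ i _ → *S-suc f g i) (λ _ _ → refl)) ⟩
  f 0 ℤ.* g 0 ℤ.* h (suc n) ℤ.+ (((λ i → f 0 ℤ.* shift g i) +S (shift f *S g)) *S h) n
    ≡⟨ cong (ℤ._+_ (f 0 ℤ.* g 0 ℤ.* h (suc n)))
         (trans (*S-distribʳ h (λ i → f 0 ℤ.* shift g i) (shift f *S g) n)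
                (cong₂ ℤ._+_ (*S-scaleˡ (f 0) (shift g) h n) (*S-assoc (shift f) g h n))) ⟩
  f 0 ℤ.* g 0 ℤ.* h (suc n) ℤ.+ (f 0 ℤ.* (shift g *S h) n ℤ.+ (shift f *S (g *S h)) n)
    ≡⟨ factor (f 0) (g 0) (h (suc n)) _ _ ⟩
  f 0 ℤ.* (g 0 ℤ.* h (suc n) ℤ.+ (shift g *S h) n) ℤ.+ (shift f *S (g *S h)) n
    ≡⟨ cong (λ x → f 0 ℤ.* x ℤ.+ (shift f *S (g *S h)) n) (*S-suc g h n) ⟨
  f 0 ℤ.* (g *S h) (suc n) ℤ.+ (shift f *S (g *S h)) n
    ≡⟨ *S-suc f (g *S h) n ⟨
  (f *S (g *S h)) (suc n) ∎
  where
  open ≡-Reasoning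
  factor : ∀ a b c x y → a ℤ.* b ℤ.* c ℤ.+ (a ℤ.* x ℤ.+ y) ≡ a ℤ.* (b ℤ.* c ℤ.+ x) ℤ.+ y
  factor = ℤ-Solver.solve-∀

*S-zeroˡ : ∀ f n → (zeroS *S f) n ≡ + 0
*S-zeroˡ f zero    = refl
*S-zeroˡ f (suc n) = trans (*S-suc zeroS f n) (trans (ℤₚ.+-identityˡ _) (*S-zeroˡ f n))

*S-identityˡ : ∀ f n → (oneS *S f) n ≡ f n
*S-identityˡ f zero    = trans (*S-zero oneS f) (ℤₚ.*-identityˡ (f 0))
*S-identityˡ f (suc n) = begin
  (oneS *S f) (suc n)                       ≡⟨ *S-suc oneS f n ⟩
  + 1 ℤ.* f (suc n) ℤ.+ (zeroS *S f) n      ≡⟨ cong₂ ℤ._+_ (ℤₚ.*-identityˡ (f (suc n))) (*S-zeroˡ f n) ⟩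
  f (suc n) ℤ.+ + 0                         ≡⟨ ℤₚ.+-identityʳ _ ⟩
  f (suc n) ∎
  where open ≡-Reasoning

-- The quotient by q^(N+1), with whole series as elements and only the equality truncated, so that
-- coefficients can be read off directly.
truncatedRing : ℕ → CommutativeRing 0ℓ 0ℓ
truncatedRing N = record
  { Carrier = Series
  ; _≈_ = λ f g → ∀ i → i ℕ.≤ N → f i ≡ g i
  ; _+_ = _+S_
  ; _*_ = _*S_
  ; -_  = -S_
  ; 0#  = zeroS
  ; 1#  = oneS
  ; isCommutativeRing = record
    { isRing = record
      { +-isAbelianGroup = record
        { isGroup = record
          { isMonoid = record
            { isSemigroup = record
              { isMagma = record
                { isEquivalence = record
                  { refl  = λ _ _ → refl
                  ; sym   = λ f≈g i i≤N → sym (f≈g i i≤N)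
                  ; trans = λ f≈g g≈h i i≤N → trans (f≈g i i≤N) (g≈h i i≤N)
                  }
                ; ∙-cong = λ f≈f′ g≈g′ i i≤N → cong₂ ℤ._+_ (f≈f′ i i≤N) (g≈g′ i i≤N)
                }
              ; assoc = λ f g h i _ → ℤₚ.+-assoc (f i) (g i) (h i)
              }
            ; identity = (λ f i _ → ℤₚ.+-identityˡ (f i)) , (λ f i _ → ℤₚ.+-identityʳ (f i))
            }
          ; inverse = (λ f i _ → ℤₚ.+-inverseˡ (f i)) , (λ f i _ → ℤₚ.+-inverseʳ (f i))
          ; ⁻¹-cong = λ f≈g i i≤N → cong -_ (f≈g i i≤N)
          }
        ; comm = λ f g i _ → ℤₚ.+-comm (f i) (g i)
        }
      ; *-cong = λ f≈f′ g≈g′ i i≤N → *S-cong i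
          (λ j j≤i → f≈f′ j (ℕₚ.≤-trans j≤i i≤N)) (λ j j≤i → g≈g′ j (ℕₚ.≤-trans j≤i i≤N))
      ; *-assoc = λ f g h i _ → *S-assoc f g h i
      ; *-identity = (λ f i _ → *S-identityˡ f i)
                   , (λ f i _ → trans (*S-comm f oneS i) (*S-identityˡ f i))
      ; distrib = (λ h f g i _ → trans (*S-comm h (f +S g) i) (trans (*S-distribʳ h f g i)
                                   (cong₂ ℤ._+_ (*S-comm f h i) (*S-comm g h i))))
                , (λ h f g i _ → *S-distribʳ h f g i)
      }
    ; *-comm = λ f g i _ → *S-comm f g i
    }
  }

-- Powers of q, the substitution of -q for q, and inverses.

qPow-zero : ∀ n → qPow 0 n ≡ oneS n
qPow-zero zero    = refl
qPow-zero (suc n) = refl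

qPow-suc : ∀ k n → qPow (suc k) (suc n) ≡ qPow k n
qPow-suc k n with k ℕ.≟ n | suc k ℕ.≟ suc n
... | yes _    | yes _    = refl
... | yes k≡n  | no 1+k≢  = contradiction (cong suc k≡n) 1+k≢
... | no k≢n   | yes 1+k≡ = contradiction (ℕₚ.suc-injective 1+k≡) k≢n
... | no _     | no _     = refl

qPow-below : ∀ {k n} → n ℕ.< k → qPow k n ≡ + 0
qPow-below {k} {n} n<k with k ℕ.≟ n
... | yes k≡n = contradiction (sym k≡n) (ℕₚ.<⇒≢ n<k)
... | no _    = refl

qPow-suc-*S-zero : ∀ k f → (qPow (suc k) *S f) 0 ≡ + 0
qPow-suc-*S-zero k f = *S-zero (qPow (suc k)) f

qPow-suc-*S-suc : ∀ k f n → (qPow (suc k) *S f) (suc n) ≡ (qPow k *S f) n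
qPow-suc-*S-suc k f n = begin
  (qPow (suc k) *S f) (suc n)                             ≡⟨ *S-suc (qPow (suc k)) f n ⟩
  + 0 ℤ.+ (shift (qPow (suc k)) *S f) n                   ≡⟨ ℤₚ.+-identityˡ _ ⟩
  (shift (qPow (suc k)) *S f) n                           ≡⟨ *S-cong n {g = f} (λ i _ → qPow-suc k i) (λ _ _ → refl) ⟩
  (qPow k *S f) n ∎
  where open ≡-Reasoning

qPow-zero-*S : ∀ f n → (qPow 0 *S f) n ≡ f n
qPow-zero-*S f n = trans (*S-cong n {g = f} (λ i _ → qPow-zero i) (λ _ _ → refl)) (*S-identityˡ f n)

qPow-+ : ∀ i j n → qPow (i ℕ.+ j) n ≡ (qPow i *S qPow j) n
qPow-+ zero    j n       = sym (qPow-zero-*S (qPow j) n)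
qPow-+ (suc i) j zero    = sym (qPow-suc-*S-zero i (qPow j))
qPow-+ (suc i) j (suc n) = begin
  qPow (suc (i ℕ.+ j)) (suc n)          ≡⟨ qPow-suc (i ℕ.+ j) n ⟩
  qPow (i ℕ.+ j) n                      ≡⟨ qPow-+ i j n ⟩
  (qPow i *S qPow j) n                  ≡⟨ qPow-suc-*S-suc i (qPow j) n ⟨
  (qPow (suc i) *S qPow j) (suc n) ∎
  where open ≡-Reasoning

qPow-*S-below : ∀ k f n → n ℕ.< k → (qPow k *S f) n ≡ + 0
qPow-*S-below (suc k) f zero    n<k       = qPow-suc-*S-zero k f
qPow-*S-below (suc k) f (suc n) (s≤s n<k) = trans (qPow-suc-*S-suc k f n) (qPow-*S-below k f n n<k)

-- Since `shift (negArg f)` is minus `negArg (shift f)`, the recursion `*S-suc` passes through the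
-- substitution.
negArg-*S : ∀ f g n → negArg (f *S g) n ≡ (negArg f *S negArg g) n
negArg-*S f g zero = begin
  + 1 ℤ.* (f *S g) 0                        ≡⟨ cong (+ 1 ℤ.*_) (*S-zero f g) ⟩
  + 1 ℤ.* (f 0 ℤ.* g 0)                     ≡⟨ split (f 0) (g 0) ⟩
  (+ 1 ℤ.* f 0) ℤ.* (+ 1 ℤ.* g 0)           ≡⟨ *S-zero (negArg f) (negArg g) ⟨
  (negArg f *S negArg g) 0 ∎
  where
  open ≡-Reasoning
  split : ∀ x y → + 1 ℤ.* (x ℤ.* y) ≡ (+ 1 ℤ.* x) ℤ.* (+ 1 ℤ.* y)
  split = ℤ-Solver.solve-∀
negArg-*S f g (suc n) = begin
  - + 1 ℤ.* s ℤ.* (f *S g) (suc n)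
    ≡⟨ cong ((- + 1 ℤ.* s) ℤ.*_) (*S-suc f g n) ⟩
  - + 1 ℤ.* s ℤ.* (f 0 ℤ.* g (suc n) ℤ.+ (shift f *S g) n)
    ≡⟨ expand s (f 0) (g (suc n)) _ ⟩
  (+ 1 ℤ.* f 0) ℤ.* (- + 1 ℤ.* s ℤ.* g (suc n)) ℤ.+ - + 1 ℤ.* (s ℤ.* (shift f *S g) n)
    ≡⟨ cong (λ x → negArg f 0 ℤ.* negArg g (suc n) ℤ.+ - + 1 ℤ.* x) (negArg-*S (shift f) g n) ⟩
  negArg f 0 ℤ.* negArg g (suc n) ℤ.+ - + 1 ℤ.* (negArg (shift f) *S negArg g) n
    ≡⟨ cong (ℤ._+_ (negArg f 0 ℤ.* negArg g (suc n))) (*S-scaleˡ (- + 1) (negArg (shift f)) (negArg g) n) ⟨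
  negArg f 0 ℤ.* negArg g (suc n) ℤ.+ ((λ i → - + 1 ℤ.* negArg (shift f) i) *S negArg g) n
    ≡⟨ cong (ℤ._+_ (negArg f 0 ℤ.* negArg g (suc n)))
         (*S-cong n {g = negArg g} (λ i _ → sym (ℤₚ.*-assoc (- + 1) ((- + 1) ℤ.^ i) (f (suc i)))) (λ _ _ → refl)) ⟩
  negArg f 0 ℤ.* negArg g (suc n) ℤ.+ (shift (negArg f) *S negArg g) n
    ≡⟨ *S-suc (negArg f) (negArg g) n ⟨
  (negArg f *S negArg g) (suc n) ∎
  where
  open ≡-Reasoning
  s = (- + 1) ℤ.^ n
  expand : ∀ s a b x → - + 1 ℤ.* s ℤ.* (a ℤ.* b ℤ.+ x) ≡
           (+ 1 ℤ.* a) ℤ.* (- + 1 ℤ.* s ℤ.* b) ℤ.+ - + 1 ℤ.* (s ℤ.* x)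
  expand = ℤ-Solver.solve-∀

negArg-oneS : ∀ n → negArg oneS n ≡ oneS n
negArg-oneS zero    = refl
negArg-oneS (suc n) = ℤₚ.*-zeroʳ ((- + 1) ℤ.^ suc n)

-- invUpTo lists coefficients from the highest degree down, so that zipping
-- against it computes a convolution.
invUpTo-zip : ∀ f (g : Series) n →
  sumℤ (zipWith ℤ._*_ (applyUpTo g (suc n)) (invUpTo f n)) ≡ (g *S invS f) n
invUpTo-zip f g zero    = sym (trans (*S-zero g (invS f)) (sym (ℤₚ.+-identityʳ _)))
invUpTo-zip f g (suc n) = begin
  g 0 ℤ.* invS f (suc n) ℤ.+ sumℤ (zipWith ℤ._*_ (applyUpTo (shift g) (suc n)) (invUpTo f n))
    ≡⟨ cong (ℤ._+_ (g 0 ℤ.* invS f (suc n))) (invUpTo-zip f (shift g) n) ⟩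
  g 0 ℤ.* invS f (suc n) ℤ.+ (shift g *S invS f) n
    ≡⟨ *S-suc g (invS f) n ⟨
  (g *S invS f) (suc n) ∎
  where open ≡-Reasoning

-- The next coefficient of the inverse is chosen as minus the rest of the convolution, and with f(0)
-- = 1 the two cancel.
invS-inverseʳ : ∀ f → f 0 ≡ + 1 → ∀ n → (f *S invS f) n ≡ oneS n
invS-inverseʳ f f0≡1 zero    = trans (*S-zero f (invS f)) (cong (ℤ._* + 1) f0≡1)
invS-inverseʳ f f0≡1 (suc n) = begin
  (f *S invS f) (suc n)
    ≡⟨ *S-suc f (invS f) n ⟩
  f 0 ℤ.* invS f (suc n) ℤ.+ (shift f *S invS f) n
    ≡⟨ cong (λ x → x ℤ.* invS f (suc n) ℤ.+ (shift f *S invS f) n) f0≡1 ⟩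
  + 1 ℤ.* invS f (suc n) ℤ.+ (shift f *S invS f) n
    ≡⟨ cong (ℤ._+ (shift f *S invS f) n) (ℤₚ.*-identityˡ (invS f (suc n))) ⟩
  invS f (suc n) ℤ.+ (shift f *S invS f) n
    ≡⟨ cong (λ x → - x ℤ.+ (shift f *S invS f) n) inv-suc ⟩
  - (shift f *S invS f) n ℤ.+ (shift f *S invS f) n
    ≡⟨ ℤₚ.+-inverseˡ ((shift f *S invS f) n) ⟩
  + 0 ∎
  where
  open ≡-Reasoning
  inv-suc : sumℤ (zipWith ℤ._*_ (map (shift f) (upTo (suc n))) (invUpTo f n)) ≡ (shift f *S invS f) n
  inv-suc = trans (cong (λ xs → sumℤ (zipWith ℤ._*_ xs (invUpTo f n))) (map-upTo (shift f) (suc n)))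
                  (invUpTo-zip f (shift f) n)

-- Enumeration of the partitions with odd smallest part.

-- `true` stands for an odd number of parts, so that `not` accounts for one part more or less.
bit : Bool → ℕ
bit false = 0
bit true  = 1

bit-not : ∀ b n → n % 2 ≡ bit b → suc n % 2 ≡ bit (not b)
bit-not false zero          _  = refl
bit-not true  (suc zero)    _  = refl
bit-not b     (suc (suc n)) eq = bit-not b n eq

bit-not⁻¹ : ∀ b n → suc n % 2 ≡ bit b → n % 2 ≡ bit (not b)
bit-not⁻¹ b n eq = bit-not b (suc n) eq

-- Multiplication by q^k at the level of lists: a family graded by n is moved up by k degrees.
delay : ∀ {A : Set} → ℕ → (ℕ → List A) → ℕ → List A
delay zero    F n       = F n
delay (suc k) F zero    = []
delay (suc k) F (suc n) = delay k F n

module _ {A : Set} (F : ℕ → List A) where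

  ∈-delay⁻ : ∀ k n {x} → x ∈ delay k F n → ∃ λ m → x ∈ F m × k ℕ.+ m ≡ n
  ∈-delay⁻ zero    n       x∈ = n , x∈ , refl
  ∈-delay⁻ (suc k) (suc n) x∈ with ∈-delay⁻ k n x∈
  ... | m , x∈F , k+m≡n = m , x∈F , cong suc k+m≡n

  ∈-delay⁺ : ∀ k m {x} → x ∈ F m → x ∈ delay k F (k ℕ.+ m)
  ∈-delay⁺ zero    m x∈ = x∈
  ∈-delay⁺ (suc k) m x∈ = ∈-delay⁺ k m x∈

  delay-unique : (∀ n → Unique (F n)) → ∀ k n → Unique (delay k F n)
  delay-unique u zero    n       = u n
  delay-unique u (suc k) zero    = []
  delay-unique u (suc k) (suc n) = delay-unique u k n

  length-delay : ∀ k n → + length (delay k F n) ≡ (qPow k *S (λ m → + length (F m))) n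
  length-delay zero    n       = sym (qPow-zero-*S (λ m → + length (F m)) n)
  length-delay (suc k) zero    = sym (qPow-suc-*S-zero k (λ m → + length (F m)))
  length-delay (suc k) (suc n) = trans (length-delay k n) (sym (qPow-suc-*S-suc k (λ m → + length (F m)) n))

single : Bool → ℕ → ℕ → List (List ℕ)
single false k n = []
single true  k n with k % 2 ℕ.≟ 1 | k ℕ.≟ n
... | yes _ | yes _ = [ [ k ] ]
... | yes _ | no  _ = []
... | no  _ | _     = []

-- Cases on the largest allowed part `suc k`: absent, placed before a nonempty partition, whose
-- smallest part it leaves unchanged, or alone. The empty partition has no smallest part, so the
-- last case is separate.
parts : Bool → ℕ → ℕ → List (List ℕ)
parts b zero    n = []
parts b (suc k) n = parts b k n ++ map (suc k ∷_) (delay (suc k) (parts (not b) k) n) ++ single b (suc k) n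

IsPart : Bool → ℕ → ℕ → List ℕ → Set
IsPart b k n xs = IsDistinctPartition n xs × All (ℕ._≤ k) xs × length xs % 2 ≡ bit b
  × Σ ℕ (λ s → last xs ≡ just s × s % 2 ≡ 1)

∈-single⁻ : ∀ b k n {xs} → xs ∈ single b k n → b ≡ true × k % 2 ≡ 1 × k ≡ n × xs ≡ [ k ]
∈-single⁻ true k n xs∈ with k % 2 ℕ.≟ 1 | k ℕ.≟ n
∈-single⁻ true k n (here xs≡) | yes odd | yes k≡n = refl , odd , k≡n , xs≡

∈-single⁺ : ∀ k → k % 2 ≡ 1 → [ k ] ∈ single true k k
∈-single⁺ k odd with k % 2 ℕ.≟ 1 | k ℕ.≟ k
... | yes _    | yes _  = here refl
... | yes _    | no k≢k = contradiction refl k≢k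
... | no ¬odd  | _      = contradiction odd ¬odd

single-unique : ∀ b k n → Unique (single b k n)
single-unique false k n = []
single-unique true  k n with k % 2 ℕ.≟ 1 | k ℕ.≟ n
... | yes _ | yes _ = [] ∷ []
... | yes _ | no  _ = []
... | no  _ | _     = []

length-single : ∀ k n → k % 2 ≡ 1 → + length (single true k n) ≡ qPow k n
length-single k n odd with k % 2 ℕ.≟ 1 | k ℕ.≟ n
... | yes _   | yes _ = refl
... | yes _   | no  _ = refl
... | no ¬odd | _     = contradiction odd ¬odd

length-single-even : ∀ k n → k % 2 ≡ 0 → length (single true k n) ≡ 0
length-single-even k n even with k % 2 ℕ.≟ 1 | k ℕ.≟ n
... | yes odd | _ = contradiction (trans (sym even) odd) (λ ())
... | no _    | _ = refl

linked-cons : ∀ {k xs} → Linked ℕ._>_ xs → All (ℕ._≤ k) xs → Linked ℕ._>_ (suc k ∷ xs)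
linked-cons []         _          = [-]
linked-cons [-]        (x≤k ∷ _)  = s≤s x≤k ∷ [-]
linked-cons (r ∷ rs)   (x≤k ∷ _)  = s≤s x≤k ∷ r ∷ rs

linked-below : ∀ {x xs} → Linked ℕ._>_ (x ∷ xs) → All (ℕ._< x) xs
linked-below l with Linked⇒AllPairs (flip ℕₚ.<-trans) l
... | x> ∷ _ = x>

parts-sound : ∀ b k n {xs} → xs ∈ parts b k n → IsPart b k n xs
parts-sound b (suc k) n xs∈ with ∈-++⁻ (parts b k n) xs∈
... | inj₁ xs∈₁ with parts-sound b k n xs∈₁
...   | dist , ≤k , len , last-odd = dist , All.map ℕₚ.m≤n⇒m≤1+n ≤k , len , last-odd
parts-sound b (suc k) n xs∈ | inj₂ xs∈₂₃
  with ∈-++⁻ (map (suc k ∷_) (delay (suc k) (parts (not b) k) n)) xs∈₂₃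
... | inj₂ xs∈₃ with ∈-single⁻ b (suc k) n xs∈₃
...   | refl , odd , refl , refl =
      ([-] , s≤s z≤n ∷ [] , ℕₚ.+-identityʳ (suc k)) , ℕₚ.≤-refl ∷ [] , refl , suc k , refl , odd
parts-sound b (suc k) n xs∈ | inj₂ xs∈₂₃ | inj₁ xs∈₂ with ∈-map⁻ (suc k ∷_) xs∈₂
-- Once the tail is known to be nonempty, `last` ignores the new head.
... | y ∷ ys , ys∈ , refl with ∈-delay⁻ (parts (not b) k) (suc k) n ys∈
...   | m , ys∈F , k+m≡n with parts-sound (not b) k m ys∈F
...     | (linked , positive , refl) , ≤k , len , last-odd =
      (linked-cons linked ≤k , s≤s z≤n ∷ positive , k+m≡n)
      , ℕₚ.≤-refl ∷ All.map ℕₚ.m≤n⇒m≤1+n ≤k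
      , bit-suc b (suc (length ys)) len , last-odd
      where
      bit-suc : ∀ b l → l % 2 ≡ bit (not b) → suc l % 2 ≡ bit b
      bit-suc false l eq = bit-not true l eq
      bit-suc true  l eq = bit-not false l eq
-- An empty tail is impossible: enumerated partitions have a last part.
parts-sound b (suc k) n xs∈ | inj₂ xs∈₂₃ | inj₁ xs∈₂ | [] , ys∈ , refl
  with ∈-delay⁻ (parts (not b) k) (suc k) n ys∈
... | m , ys∈F , _ with parts-sound (not b) k m ys∈F
...   | _ , _ , _ , _ , () , _

parts-complete : ∀ b k n {xs} → IsPart b k n xs → xs ∈ parts b k n
parts-complete b k n {[]} (_ , _ , _ , _ , () , _)
parts-complete b zero n {x ∷ xs} ((_ , 1≤x ∷ _ , _) , x≤0 ∷ _ , _) =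
  contradiction (ℕₚ.≤-trans 1≤x x≤0) λ ()
parts-complete b (suc k) n {x ∷ xs} (dist@(linked , _) , x≤1+k ∷ _ , len , last-odd)
  with x ℕ.≟ suc k
... | no x≢1+k = ∈-++⁺ˡ (parts-complete b k n (dist , x≤k ∷ All.map below (linked-below linked) , len , last-odd))
  where
  x≤k = ℕ.s≤s⁻¹ (ℕₚ.≤∧≢⇒< x≤1+k x≢1+k)
  below : ∀ {y} → y ℕ.< x → y ℕ.≤ k
  below y<x = ℕₚ.≤-trans (ℕₚ.<⇒≤ y<x) x≤k
parts-complete true (suc k) n {x ∷ []} ((_ , _ , sum) , _ , len , s , last≡ , odd) | yes refl
  with just-injective last≡ | trans (sym (ℕₚ.+-identityʳ (suc k))) sum
... | refl | refl = ∈-++⁺ʳ (parts true k n)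
      (∈-++⁺ʳ (map (suc k ∷_) (delay (suc k) (parts false k) n)) (∈-single⁺ (suc k) odd))
parts-complete false (suc k) n {x ∷ []} (_ , _ , () , _) | yes refl
parts-complete b (suc k) n {x ∷ ys@(_ ∷ _)} ((linked , _ ∷ positive , refl) , _ , len , last-odd) | yes refl =
  ∈-++⁺ʳ (parts b k n) (∈-++⁺ˡ (∈-map⁺ (suc k ∷_) (∈-delay⁺ (parts (not b) k) (suc k) (foldr ℕ._+_ 0 ys)
    (parts-complete (not b) k _
      ((Linked.tail linked , positive , refl) , All.map ℕ.s≤s⁻¹ (linked-below linked)
      , bit-not⁻¹ b (length ys) len , last-odd)))))

-- The three sublists are disjoint: in the first all parts are at most k, the other two start with
-- `suc k`, followed by a nonempty tail in the second and by nothing in the third.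
parts-unique : ∀ b k n → Unique (parts b k n)
parts-unique b zero    n = []
parts-unique b (suc k) n = Uniqueₚ.++⁺ (parts-unique b k n)
  (Uniqueₚ.++⁺ (Uniqueₚ.map⁺ ∷-injectiveʳ (delay-unique (parts (not b) k) (parts-unique (not b) k) (suc k) n))
    (single-unique b (suc k) n) cons-not-single)
  (λ (xs∈₁ , xs∈₂₃) → small-not-large (proj₁ (proj₂ (parts-sound b k n xs∈₁))) xs∈₂₃)
  where
  consed = map (suc k ∷_) (delay (suc k) (parts (not b) k) n)
  cons-not-single : ∀ {xs} → ¬ (xs ∈ consed × xs ∈ single b (suc k) n)
  cons-not-single (xs∈₂ , xs∈₃) with ∈-map⁻ (suc k ∷_) xs∈₂ | ∈-single⁻ b (suc k) n xs∈₃
  ... | ys , ys∈ , refl | _ , _ , _ , xs≡ with ∷-injectiveʳ xs≡ | ∈-delay⁻ (parts (not b) k) (suc k) n ys∈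
  ...   | refl | m , []∈ , _ with parts-sound (not b) k m []∈
  ...     | _ , _ , _ , _ , () , _
  small-not-large : ∀ {xs} → All (ℕ._≤ k) xs → ¬ (xs ∈ consed ++ single b (suc k) n)
  small-not-large ≤k xs∈ with ∈-++⁻ consed xs∈
  ... | inj₁ xs∈₂ with ∈-map⁻ (suc k ∷_) xs∈₂
  small-not-large (1+k≤k ∷ _) xs∈ | inj₁ xs∈₂ | _ , _ , refl = ℕₚ.1+n≰n 1+k≤k
  small-not-large ≤k xs∈ | inj₂ xs∈₃ with ∈-single⁻ b (suc k) n xs∈₃
  small-not-large (1+k≤k ∷ _) xs∈ | inj₂ xs∈₃ | _ , _ , _ , refl = ℕₚ.1+n≰n 1+k≤k

-- Generating functions of the enumeration, and signs of powers at -q.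

count : Bool → ℕ → Series
count b k n = + length (parts b k n)

count-suc : ∀ b k n → count b (suc k) n ≡
  count b k n ℤ.+ (qPow (suc k) *S count (not b) k) n ℤ.+ + length (single b (suc k) n)
count-suc b k n = begin
  + length (parts b k n ++ consed ++ single b (suc k) n)
    ≡⟨ cong +_ (trans (length-++ (parts b k n)) (cong (length (parts b k n) ℕ.+_) (length-++ consed))) ⟩
  + (length (parts b k n) ℕ.+ (length consed ℕ.+ length (single b (suc k) n)))
    ≡⟨ cong +_ (ℕₚ.+-assoc (length (parts b k n)) _ _) ⟨
  count b k n ℤ.+ + length consed ℤ.+ + length (single b (suc k) n)
    ≡⟨ cong (λ x → count b k n ℤ.+ x ℤ.+ + length (single b (suc k) n))
         (trans (cong +_ (length-map (suc k ∷_) (delay (suc k) (parts (not b) k) n))) (length-delay (parts (not b) k) (suc k) n)) ⟩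
  count b k n ℤ.+ (qPow (suc k) *S count (not b) k) n ℤ.+ + length (single b (suc k) n) ∎
  where
  open ≡-Reasoning
  consed = map (suc k ∷_) (delay (suc k) (parts (not b) k) n)

count-suc-without-single : ∀ b k n → length (single b (suc k) n) ≡ 0 →
  count b (suc k) n ≡ count b k n ℤ.+ (qPow (suc k) *S count (not b) k) n
count-suc-without-single b k n none = trans (count-suc b k n)
  (trans (cong (λ l → count b k n ℤ.+ (qPow (suc k) *S count (not b) k) n ℤ.+ + l) none) (ℤₚ.+-identityʳ _))

≤-sum : ∀ xs → All (ℕ._≤ foldr ℕ._+_ 0 xs) xs
≤-sum []       = []
≤-sum (x ∷ xs) = ℕₚ.m≤m+n x _ ∷ All.map (λ y≤ → ℕₚ.≤-trans y≤ (ℕₚ.m≤n+m _ x)) (≤-sum xs)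

negArg-qPow : ∀ k n → negArg (qPow k) n ≡ (- + 1) ℤ.^ k ℤ.* qPow k n
negArg-qPow k n with k ℕ.≟ n
... | yes refl = refl
... | no _     = trans (ℤₚ.*-zeroʳ ((- + 1) ℤ.^ n)) (sym (ℤₚ.*-zeroʳ ((- + 1) ℤ.^ k)))

-1^even : ∀ m → (- + 1) ℤ.^ (2 ℕ.* m) ≡ + 1
-1^even m = trans (sym (ℤₚ.^-*-assoc (- + 1) 2 m)) (ℤₚ.^-zeroˡ m)

negArg-qPow-even : ∀ m n → negArg (qPow (2 ℕ.* m)) n ≡ qPow (2 ℕ.* m) n
negArg-qPow-even m n = trans (negArg-qPow (2 ℕ.* m) n)
  (trans (cong (ℤ._* qPow (2 ℕ.* m) n) (-1^even m)) (ℤₚ.*-identityˡ _))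

negArg-qPow-odd : ∀ m n → negArg (qPow (1 ℕ.+ 2 ℕ.* m)) n ≡ - qPow (1 ℕ.+ 2 ℕ.* m) n
negArg-qPow-odd m n = trans (negArg-qPow (1 ℕ.+ 2 ℕ.* m) n)
  (trans (cong (λ x → - + 1 ℤ.* x ℤ.* qPow (1 ℕ.+ 2 ℕ.* m) n) (-1^even m)) (ℤₚ.-1*i≡-i _))

-- Translation of the given series into the truncated ring.

module Truncated (N : ℕ) where
  open CommutativeRing (truncatedRing N)
    using (_≈_; setoid; _+_; _*_; +-congˡ; +-congʳ; *-cong; *-congˡ; *-congʳ; distribˡ; -‿inverseˡ; zeroʳ)
    renaming (trans to ≈-trans)
  open NilpotentBase (truncatedRing N)

  -- The additional factors are 1 + q^(k+1) with k ≥ m ≥ i, which agree with 1 up to degree i.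
  ∏-stable : ∀ i d m → i ℕ.≤ m → ∏ (d ℕ.+ m) (λ k → oneS +S qPow (suc k)) i ≡ ∏ m (λ k → oneS +S qPow (suc k)) i
  ∏-stable i zero    m i≤m = refl
  ∏-stable i (suc d) m i≤m = begin
    (∏ (d ℕ.+ m) F *S F (d ℕ.+ m)) i   ≡⟨ *S-cong i {f = ∏ (d ℕ.+ m) F} (λ _ _ → refl) F≡1 ⟩
    (∏ (d ℕ.+ m) F *S oneS) i          ≡⟨ *S-comm (∏ (d ℕ.+ m) F) oneS i ⟩
    (oneS *S ∏ (d ℕ.+ m) F) i          ≡⟨ *S-identityˡ (∏ (d ℕ.+ m) F) i ⟩
    ∏ (d ℕ.+ m) F i                    ≡⟨ ∏-stable i d m i≤m ⟩
    ∏ m F i ∎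
    where
    open ≡-Reasoning
    F : ℕ → Series
    F k = oneS +S qPow (suc k)
    F≡1 : ∀ j → j ℕ.≤ i → F (d ℕ.+ m) j ≡ oneS j
    F≡1 j j≤i = trans (cong (ℤ._+_ (oneS j)) (qPow-below (s≤s (ℕₚ.≤-trans j≤i (ℕₚ.≤-trans i≤m (ℕₚ.m≤n+m m d))))))
                      (ℤₚ.+-identityʳ (oneS j))

  prodS≡∏ : ∀ m F → prodS m F ≡ ∏ m F
  prodS≡∏ zero    F = refl
  prodS≡∏ (suc m) F = cong (_*S F m) (prodS≡∏ m F)

  -- By definition the number of factors varies with the coefficient; one product of 2N+2 factors
  -- serves all degrees up to N and suits `∏-pairs`.
  poch-q-inf≈∏ : poch-q-inf ≈ ∏ (suc N ℕ.+ suc N) (λ k → oneS +S qPow (suc k))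
  poch-q-inf≈∏ i i≤N = begin
    prodS i F i                          ≡⟨ cong (λ f → f i) (prodS≡∏ i F) ⟩
    ∏ i F i                              ≡⟨ ∏-stable i (suc N ℕ.+ suc N ℕ.∸ i) i ℕₚ.≤-refl ⟨
    ∏ (suc N ℕ.+ suc N ℕ.∸ i ℕ.+ i) F i  ≡⟨ cong (λ k → ∏ k F i) (ℕₚ.m∸n+n≡m i≤2N+2) ⟩
    ∏ (suc N ℕ.+ suc N) F i ∎
    where
    open ≡-Reasoning
    F : ℕ → Series
    F k = oneS +S qPow (suc k)
    i≤2N+2 : i ℕ.≤ suc N ℕ.+ suc N
    i≤2N+2 = ℕₚ.≤-trans i≤N (ℕₚ.≤-trans (ℕₚ.n≤1+n N) (ℕₚ.m≤m+n (suc N) (suc N)))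

  sumℤ-∷ʳ : ∀ xs x → sumℤ (xs ∷ʳ x) ≡ sumℤ xs ℤ.+ x
  sumℤ-∷ʳ []       x = trans (ℤₚ.+-identityʳ x) (sym (ℤₚ.+-identityˡ x))
  sumℤ-∷ʳ (y ∷ xs) x = trans (cong (ℤ._+_ y) (sumℤ-∷ʳ xs x)) (sym (ℤₚ.+-assoc y _ x))

  sumℤ≡∑ : ∀ k F i → sumℤ (map (λ m → F m i) (upTo k)) ≡ ∑ k F i
  sumℤ≡∑ zero    F i = refl
  sumℤ≡∑ (suc k) F i = begin
    sumℤ (map f (upTo (suc k)))       ≡⟨ cong (sumℤ ∘ map f) (upTo-∷ʳ k) ⟨
    sumℤ (map f (upTo k ∷ʳ k))        ≡⟨ cong sumℤ (map-++ f (upTo k) [ k ]) ⟩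
    sumℤ (map f (upTo k) ∷ʳ f k)      ≡⟨ sumℤ-∷ʳ (map f (upTo k)) (f k) ⟩
    sumℤ (map f (upTo k)) ℤ.+ f k     ≡⟨ cong (ℤ._+ f k) (sumℤ≡∑ k F i) ⟩
    ∑ k F i ℤ.+ f k ∎
    where
    open ≡-Reasoning
    f : ℕ → ℤ
    f m = F m i

  ∑-stable : ∀ F i → (∀ m → i ℕ.< m → F m i ≡ + 0) → ∀ d → ∑ (d ℕ.+ suc i) F i ≡ ∑ (suc i) F i
  ∑-stable F i F-below zero    = refl
  ∑-stable F i F-below (suc d) = trans (cong (ℤ._+_ (∑ (d ℕ.+ suc i) F i)) (F-below _ (ℕₚ.m≤n+m (suc i) d)))
    (trans (ℤₚ.+-identityʳ _) (∑-stable F i F-below d))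

  negArg-∑ : ∀ k F i → negArg (∑ k F) i ≡ ∑ k (negArg ∘ F) i
  negArg-∑ zero    F i = ℤₚ.*-zeroʳ ((- + 1) ℤ.^ i)
  negArg-∑ (suc k) F i = trans (ℤₚ.*-distribˡ-+ ((- + 1) ℤ.^ i) (∑ k F i) (F k i))
    (cong (ℤ._+ negArg (F k) i) (negArg-∑ k F i))

  -- As m² and m have the same parity, `t m` is (-1)^m q^(m²).
  t I : ℕ → Series
  t m = negArg (qPow (m ℕ.* m))
  I m = negArg (invS (poch-q2 m))

  m≤m*m : ∀ m → m ℕ.≤ m ℕ.* m
  m≤m*m zero    = z≤n
  m≤m*m (suc m) = ℕₚ.m≤m*n (suc m) (suc m)

  negArg-phi≈∑ : negArg phi ≈ ∑ (suc N) (λ m → t m * I m)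
  negArg-phi≈∑ i i≤N = begin
    (- + 1) ℤ.^ i ℤ.* sumℤ (map (λ m → F m i) (upTo (suc i)))
      ≡⟨ cong (ℤ._*_ ((- + 1) ℤ.^ i)) (sumℤ≡∑ (suc i) F i) ⟩
    (- + 1) ℤ.^ i ℤ.* ∑ (suc i) F i
      -- The terms with m > i start at degree m² ≥ m and do not reach degree i, so the sum can be
      -- extended to the uniform length `suc N`.
      ≡⟨ cong (ℤ._*_ ((- + 1) ℤ.^ i)) (∑-stable F i F-below (N ℕ.∸ i)) ⟨
    (- + 1) ℤ.^ i ℤ.* ∑ (N ℕ.∸ i ℕ.+ suc i) F i
      ≡⟨ cong (λ k → (- + 1) ℤ.^ i ℤ.* ∑ k F i) (trans (ℕₚ.+-suc (N ℕ.∸ i) i) (cong suc (ℕₚ.m∸n+n≡m i≤N))) ⟩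
    negArg (∑ (suc N) F) i
      ≡⟨ negArg-∑ (suc N) F i ⟩
    ∑ (suc N) (negArg ∘ F) i
      ≡⟨ ∑-cong (suc N) (λ m j _ → negArg-*S (qPow (m ℕ.* m)) (invS (poch-q2 m)) j) i i≤N ⟩
    ∑ (suc N) (λ m → t m * I m) i ∎
    where
    open ≡-Reasoning
    F : ℕ → Series
    F m = qPow (m ℕ.* m) *S invS (poch-q2 m)
    F-below : ∀ m → i ℕ.< m → F m i ≡ + 0
    F-below m i<m = qPow-*S-below (m ℕ.* m) (invS (poch-q2 m)) i (ℕₚ.<-≤-trans i<m (m≤m*m m))

  t-zero : t 0 ≈ oneS
  t-zero i _ = trans (cong (ℤ._*_ ((- + 1) ℤ.^ i)) (qPow-zero i)) (negArg-oneS i)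

  -- From (m+1)² = m² + (2m+1): the odd exponent 2m+1 supplies the change of sign.
  t-suc : ∀ m → t (suc m) + t m * qPow (1 ℕ.+ 2 ℕ.* m) ≈ zeroS
  t-suc m = begin
    t (suc m) + t m * q
      ≈⟨ +-congʳ {t m * q} {t (suc m)} {t m * negArg q} t-split ⟩
    t m * negArg q + t m * q
      ≈⟨ +-congʳ {t m * q} {t m * negArg q} {t m * (-S q)} (*-congˡ {t m} {negArg q} (λ i _ → negArg-qPow-odd m i)) ⟩
    t m * (-S q) + t m * q
      ≈⟨ distribˡ (t m) (-S q) q ⟨
    t m * ((-S q) + q)
      ≈⟨ *-congˡ {t m} (-‿inverseˡ q) ⟩
    t m * zeroS
      ≈⟨ zeroʳ (t m) ⟩
    zeroS ∎
    where
    open import Relation.Binary.Reasoning.Setoid setoid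
    q : Series
    q = qPow (1 ℕ.+ 2 ℕ.* m)
    square : ∀ m → suc m ℕ.* suc m ≡ m ℕ.* m ℕ.+ (1 ℕ.+ 2 ℕ.* m)
    square = ℕ-Solver.solve-∀
    t-split : t (suc m) ≈ t m * negArg q
    t-split i _ = trans (cong (λ k → negArg (qPow k) i) (square m))
      (trans (cong (ℤ._*_ ((- + 1) ℤ.^ i)) (qPow-+ (m ℕ.* m) (1 ℕ.+ 2 ℕ.* m) i))
             (negArg-*S (qPow (m ℕ.* m)) q i))

  prodS-head : ∀ m F → (∀ j → F j 0 ≡ + 1) → prodS m F 0 ≡ + 1
  prodS-head zero    F F0≡1 = refl
  prodS-head (suc m) F F0≡1 = trans (*S-zero (prodS m F) (F m)) (cong₂ ℤ._*_ (prodS-head m F F0≡1) (F0≡1 m))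

  negArg-prodS : ∀ m F → (∀ j n → negArg (F j) n ≡ F j n) → ∀ n → negArg (prodS m F) n ≡ prodS m F n
  negArg-prodS zero    F F-even n = negArg-oneS n
  negArg-prodS (suc m) F F-even n = trans (negArg-*S (prodS m F) (F m) n)
    (*S-cong n (λ i _ → negArg-prodS m F F-even i) (λ i _ → F-even m i))

  q2-factor-even : ∀ j n → negArg (oneS +S qPow (2 ℕ.+ 2 ℕ.* j)) n ≡ (oneS +S qPow (2 ℕ.+ 2 ℕ.* j)) n
  q2-factor-even j n = trans (ℤₚ.*-distribˡ-+ ((- + 1) ℤ.^ n) (oneS n) _) (cong₂ ℤ._+_ (negArg-oneS n) qPow-even)
    where
    qPow-even : negArg (qPow (2 ℕ.+ 2 ℕ.* j)) n ≡ qPow (2 ℕ.+ 2 ℕ.* j) n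
    qPow-even = subst (λ k → negArg (qPow k) n ≡ qPow k n) (ℕₚ.*-suc 2 j) (negArg-qPow-even (suc j) n)

  -- (-q²;q²)_m is even in q and thus fixed by the substitution of -q, which is multiplicative and
  -- so carries inverses to inverses.
  I-inverse : ∀ m → I m * ∏ m (λ j → oneS +S qPow (2 ℕ.+ 2 ℕ.* j)) ≈ oneS
  I-inverse m i _ = begin
    (I m *S ∏ m (λ j → oneS +S qPow (2 ℕ.+ 2 ℕ.* j))) i
      ≡⟨ cong (λ f → (I m *S f) i) (prodS≡∏ m _) ⟨
    (I m *S poch-q2 m) i
      ≡⟨ *S-cong i {f = I m} (λ _ _ → refl) (λ j _ → negArg-prodS m _ q2-factor-even j) ⟨
    (I m *S negArg (poch-q2 m)) i
      ≡⟨ negArg-*S (invS (poch-q2 m)) (poch-q2 m) i ⟨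
    negArg (invS (poch-q2 m) *S poch-q2 m) i
      ≡⟨ cong (ℤ._*_ ((- + 1) ℤ.^ i)) (*S-comm (invS (poch-q2 m)) (poch-q2 m) i) ⟩
    negArg (poch-q2 m *S invS (poch-q2 m)) i
      ≡⟨ cong (ℤ._*_ ((- + 1) ℤ.^ i)) (invS-inverseʳ (poch-q2 m) (prodS-head m _ (λ _ → refl)) i) ⟩
    negArg oneS i
      ≡⟨ negArg-oneS i ⟩
    oneS i ∎
    where open ≡-Reasoning

  product≈1+2count : (poch-q-inf *S negArg phi) ≈ oneS + (count false (2 ℕ.* suc N) + count false (2 ℕ.* suc N))
  product≈1+2count = ≈-trans
    {poch-q-inf *S negArg phi}
    {∏ (suc N ℕ.+ suc N) (λ k → oneS +S qPow (suc k)) * ∑ (suc N) (λ m → t m * I m)}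
    (*-cong {poch-q-inf} {_} {negArg phi} poch-q-inf≈∏ negArg-phi≈∑)
    (MockTheta.mock-theta N qPow
      (λ i _ → qPow-zero i) (λ i j k _ → qPow-+ i j k) (λ i N<i k k≤N → qPow-below (ℕₚ.≤-<-trans k≤N N<i))
      t t-zero t-suc
      (count false) (count true) (λ _ _ → refl) (λ _ _ → refl)
      -- A single part never gives an even number of parts; for an odd number, it contributes
      -- q^(2j+1) when the new part is 2j+1 and nothing when it is 2j+2.
      (λ k i _ → count-suc-without-single false k i refl)
      (λ j i _ → trans (count-suc true (2 ℕ.* j) i)
        (cong (ℤ._+_ (count true (2 ℕ.* j) i ℤ.+ (qPow (1 ℕ.+ 2 ℕ.* j) *S count false (2 ℕ.* j)) i))
          (length-single (1 ℕ.+ 2 ℕ.* j) i (2j-% 1 j))))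
      (λ j i _ → count-suc-without-single true (1 ℕ.+ 2 ℕ.* j) i
        (length-single-even (2 ℕ.+ 2 ℕ.* j) i (2j-% 2 j)))
      I I-inverse)
    where
    2j-% : ∀ r j → (r ℕ.+ 2 ℕ.* j) % 2 ≡ r % 2
    2j-% r j = trans (cong (λ k → (r ℕ.+ k) % 2) (ℕₚ.*-comm 2 j)) ([m+kn]%n≡m%n r j 2)

-- The theorem, coefficient by coefficient.

open import Data.Nat using (_≤_; _*_)

theorem1p5 : ((poch-q-inf *S negArg phi) 0 ≡ + 1)
    × ((n : ℕ) → 1 ≤ n →
    Σ (List (List ℕ)) (λ L →
    Unique L × ((xs : List ℕ) → (xs ∈ L) ⇔ IsPdoE n xs)
    × ((poch-q-inf *S negArg phi) n ≡ + (2 * length L))))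
theorem1p5 = refl , λ n 1≤n → parts false (2 ℕ.* suc n) n , parts-unique false (2 ℕ.* suc n) n
  , (λ xs → mk⇔
      (λ xs∈ → let dist , _ , len , last-odd = parts-sound false (2 ℕ.* suc n) n xs∈ in dist , len , last-odd)
      (λ (dist , len , last-odd) → parts-complete false (2 ℕ.* suc n) n (dist , bounded n xs dist , len , last-odd)))
  , twice n 1≤n
  where
  -- No part exceeds the sum n, so the bound on the parts inherited from the truncated identity
  -- excludes no partition of n.
  bounded : ∀ n xs → IsDistinctPartition n xs → All (ℕ._≤ 2 ℕ.* suc n) xs
  bounded n xs (_ , _ , refl) =
    All.map (λ x≤n → ℕₚ.≤-trans x≤n (ℕₚ.≤-trans (ℕₚ.n≤1+n n) (ℕₚ.m≤m+n (suc n) _))) (≤-sum xs)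
  twice : ∀ n → 1 ℕ.≤ n → (poch-q-inf *S negArg phi) n ≡ + (2 ℕ.* length (parts false (2 ℕ.* suc n) n))
  -- Truncation at N keeps the coefficient of q^N, so N is the degree being read off; there the
  -- constant series 1 contributes zero.
  twice (suc n) _ = trans (Truncated.product≈1+2count (suc n) (suc n) ℕₚ.≤-refl)
    (trans (ℤₚ.+-identityˡ _) (cong (λ l → + (length L ℕ.+ l)) (sym (ℕₚ.+-identityʳ (length L)))))
    where L = parts false (2 ℕ.* suc (suc n)) (suc n)
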